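{- Let $k\ge2$ and $n\ge1$. If $\gamma^{(1)},\ldots,\gamma^{(k)},\delta^{(1)},\ldots,\delta^{(k)}$ are compositions of $n$ such that $\ell(\gamma^{(t)})=\ell(\delta^{(t)})$ for all $t\in[k]$ (where $\ell$ denotes the length), then the sets $\mathcal{T}_{\gamma^{(1)},\ldots,\gamma^{(k)}}$ and $\mathcal{T}_{\delta^{(1)},\ldots,\delta^{(k)}}$ are in bijection, where $\mathcal{T}_{\gamma^{(1)},\ldots,\gamma^{(k)}}$ denotes the set of vertex-labelled tree-rooted $k$-constellations of vertex-compositions $(\gamma^{(1)},\ldots,\gamma^{(k)})$.
   Context: $[m]=\{1,\ldots,m\}$. A composition of $n$ is a finite sequence of positive integers with sum $n$; its length is its number of parts. A map is a cellular embedding (all faces simply connected) of a connected graph (loops and multiple edges allowed) in an oriented compact connected surface without boundary, considered up to orientation preserving homeomorphism. A $k$-constellation is a map with black and white faces and with vertices of types $1,\ldots,k$ (types taken modulo $k$) such that (i) each edge separates a black face and a white face, and (ii) each black face has degree $k$ and is incident to vertices of type $1,2,\ldots,k$ in this order clockwise around the face. Black faces are called hyperedges; the size is the number of hyperedges. An edge has type $t\in[k]$ if, clockwise around its incident hyperedge, it goes from a vertex of type $t$ to a vertex of type $t+1$; thus each hyperedge is incident to exactly one vertex and one edge of each type. Standard combinatorial encoding: $k$-constellations with hyperedges labelled by $[n]$ correspond bijectively to tuples $(\pi_1,\ldots,\pi_k)$ of permutations of $[n]$ generating a transitive group, the cycles of $\pi_t$ being the counterclockwise orders of the hyperedges around the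 vertices of type $t$. A constellation is rooted if one hyperedge is distinguished (root hyperedge); its root vertex is the vertex of type $k$ incident to the root hyperedge. The hyperdegree of a vertex is the number of incident hyperedges. A constellation with $p_t$ vertices of type $t$ for each $t$ is vertex-labelled if for each $t\in[k]$ its $p_t$ vertices of type $t$ have distinct labels in $[p_t]$; a vertex-labelled constellation of size $n$ has vertex-compositions $(\gamma^{(1)},\ldots,\gamma^{(k)})$ if, for all $t$, $\gamma^{(t)}$ is the composition of $n$ of length $p_t$ whose $i$th part is the hyperdegree of the vertex of type $t$ labelled $i$. For a vertex $v_0$ of a constellation $C$, a $v_0$-arborescence of $C$ is a spanning tree $A$ of (the underlying graph of) $C$ such that every vertex $v\ne v_0$ of type $t$ is incident to exactly one edge of type $t$ in $A$. A tree-rooted constellation is a pair $(C,A)$ where $C$ is a rooted constellation and $A$ is a $v_0$-arborescence of $C$, with $v_0$ the root vertex of $C$. -}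

module Defs where

open import Data.Nat.Base using (ℕ; suc; _<_; NonTrivial; nonTrivial⇒nonZero)
open import Data.Nat.ListAction using (sum)
open import Data.Nat.DivMod using (_mod_)
open import Data.Fin.Base using (Fin; toℕ)
open import Data.Fin.Properties using (_≟_)
open import Data.Fin.Permutation as Perm
  using (Permutation′; _⟨$⟩ʳ_; _∘ₚ_; flip)
open import Data.Fin.Subset using (Subset; _∈_)
open import Data.List.Base using (List; []; _∷_; length; lookup)
open import Data.List.Relation.Unary.All using (All)
open import Data.List.Relation.Unary.Unique.Propositional using (Unique)
open import Data.Product.Base using (_×_; _,_; ∃; ∃-syntax)
open import Data.Product using (∃!)
open import Data.Sum.Base using (_⊎_)
open import Data.Unit.Base using (⊤)
import Data.Vec.Base as Vec
open import Function.Base using (const)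
open import Function.Bundles using (Bijection; _⇔_; mk⇔; Equivalence)
open import Level using (0ℓ)
open import Relation.Binary.Bundles using (Setoid)
open import Relation.Binary.Core using (Rel)
open import Relation.Binary.Structures using (IsEquivalence)
open import Relation.Binary.PropositionalEquality
  using (_≡_; refl; sym; trans; cong; subst; setoid; module ≡-Reasoning)
open import Relation.Nullary.Negation using (¬_)
open import Relation.Unary using (Pred)


------------------------------------------------------------------------
-- Compositions

record Composition (n : ℕ) : Set where
  field
    parts     : List ℕ
    positive  : All (0 <_) parts
    sum-parts : sum parts ≡ n

ℓ : ∀ {n} → Composition n → ℕ
ℓ γ = length (Composition.parts γ)

part : ∀ {n} (γ : Composition n) → Fin (ℓ γ) → ℕ
part γ = lookup (Composition.parts γ)

------------------------------------------------------------------------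
-- Permutation groups

data Generated {I : Set} {n : ℕ} (π : I → Permutation′ n) :
               Pred (Permutation′ n) 0ℓ where
  generator : ∀ i → Generated π (π i)
  identity  : Generated π Perm.id
  compose   : ∀ {ρ σ} → Generated π ρ → Generated π σ → Generated π (ρ ∘ₚ σ)
  inverse   : ∀ {ρ} → Generated π ρ → Generated π (flip ρ)

SameOrbit : {I : Set} {n : ℕ} → (I → Permutation′ n) → Rel (Fin n) 0ℓ
SameOrbit π h h′ = ∃[ ρ ] Generated π ρ × ρ ⟨$⟩ʳ h ≡ h′

Transitive : {I : Set} {n : ℕ} → (I → Permutation′ n) → Set
Transitive π = ∀ h h′ → SameOrbit π h h′

-- The cycles of a permutation are the orbits of the group it generates.
SameCycle : ∀ {n} → Permutation′ n → Rel (Fin n) 0ℓ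
SameCycle π = SameOrbit {I = ⊤} (const π)

SameOrbit-isEquivalence : ∀ {I : Set} {n} (π : I → Permutation′ n) →
                          IsEquivalence (SameOrbit π)
SameOrbit-isEquivalence π = record
  { refl  = Perm.id , identity , refl
  ; sym   = λ { (ρ , g , refl) → flip ρ , inverse g , Perm.inverseˡ ρ }
  ; trans = λ { (ρ , g , refl) (σ , g′ , refl) → ρ ∘ₚ σ , compose g g′ , refl }
  }

------------------------------------------------------------------------
-- Multigraphs (loops and multiple edges allowed)

-- Vertices are a setoid, so that cycles of a permutation can be vertices.
-- Each edge comes with a direction, which walks ignore.
record Multigraph : Set₁ where
  field
    vertices      : Setoid 0ℓ 0ℓ
    Edge          : Set
    source target : Edge → Setoid.Carrier vertices

  open Setoid vertices public using () renaming (Carrier to Vertex; _≈_ to _≈ᵥ_)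

  Incident : Edge → Vertex → Set
  Incident e v = source e ≈ᵥ v ⊎ target e ≈ᵥ v

  Joins : Edge → Vertex → Vertex → Set
  Joins e u v = (source e ≈ᵥ u × target e ≈ᵥ v) ⊎ (source e ≈ᵥ v × target e ≈ᵥ u)

  module _ (A : Pred Edge 0ℓ) where

    data Walk : Vertex → Vertex → Set where
      stop : ∀ {u v} → u ≈ᵥ v → Walk u v
      step : ∀ {u v w} (e : Edge) → A e → Joins e u v → Walk v w → Walk u w

    edges : ∀ {u v} → Walk u v → List Edge
    edges (stop _)       = []
    edges (step e _ _ w) = e ∷ edges w

    Connected : Set
    Connected = ∀ u v → Walk u v

    -- No closed walk traverses at least one edge without repeating any.
    Acyclic : Set
    Acyclic = ∀ {v} (w : Walk v v) → Unique (edges w) → edges w ≡ []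

    IsSpanningTree : Set
    IsSpanningTree = Connected × Acyclic

------------------------------------------------------------------------
-- Constellations

-- Vertex and edge types are residues modulo k: type k is the residue 0.
next : ∀ {k} .{{_ : NonTrivial k}} → Fin k → Fin k
next {k} t = _mod_ (suc (toℕ t)) k {{nonTrivial⇒nonZero k}}

type-k : ∀ {k} .{{_ : NonTrivial k}} → Fin k
type-k {k} = _mod_ k k {{nonTrivial⇒nonZero k}}

-- A k-constellation of size n with hyperedges labelled by Fin n, given by the
-- counterclockwise orders π t of the hyperedges around the vertices of type t.
-- The labels of the hyperedges are forgotten in 𝒯 below, by identifying
-- isomorphic objects.
record Constellation (k n : ℕ) : Set where
  field
    π          : Fin k → Permutation′ n
    transitive : Transitive π

  verticesOfType : Fin k → Setoid 0ℓ 0ℓ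
  verticesOfType t = record { isEquivalence = SameOrbit-isEquivalence (const {B = ⊤} (π t)) }

  -- The pair (t , h) stands for the vertex of type t incident to the
  -- hyperedge h, that is, for the cycle of π t containing h.
  allVertices : Setoid 0ℓ 0ℓ
  allVertices = record
    { Carrier       = Fin k × Fin n
    ; _≈_           = λ { (t , h) (t′ , h′) → t ≡ t′ × SameCycle (π t) h h′ }
    ; isEquivalence = record
      { refl  = λ { {t , _} → refl , Setoid.refl (verticesOfType t) }
      ; sym   = λ { {t , _} (refl , c) → refl , Setoid.sym (verticesOfType t) c }
      ; trans = λ { {t , _} (refl , c) (refl , d) →
                    refl , Setoid.trans (verticesOfType t) c d }
      }
    }

  -- The edge (t , h) is the edge of type t of the hyperedge h.
  underlyingGraph : .{{NonTrivial k}} → Multigraph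
  underlyingGraph = record
    { vertices = allVertices
    ; Edge     = Fin k × Fin n
    ; source   = λ { (t , h) → t , h }
    ; target   = λ { (t , h) → next t , h }
    }

-- A set of edges is given by, for each type t, the set of those hyperedges
-- whose edge of type t belongs to it.
EdgeSet : ℕ → ℕ → Set
EdgeSet k n = Fin k → Subset n

_∈ₑ_ : ∀ {k n} → Fin k × Fin n → EdgeSet k n → Set
(t , h) ∈ₑ A = h ∈ A t

record IsArborescence {k n} .{{_ : NonTrivial k}} (C : Constellation k n)
                      (v₀ : Fin k × Fin n) (A : EdgeSet k n) : Set where
  open Multigraph (Constellation.underlyingGraph C)
  field
    spanningTree : IsSpanningTree (_∈ₑ A)
    uniqueEdge   : ∀ t h → ¬ (t , h) ≈ᵥ v₀ →
                   ∃! _≡_ λ h′ → (t , h′) ∈ₑ A × Incident (t , h′) (t , h)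

record TreeRootedConstellation (k n : ℕ) .{{_ : NonTrivial k}} : Set where
  field
    constellation : Constellation k n
    root          : Fin n

  open Constellation constellation public

  rootVertex : Fin k × Fin n
  rootVertex = type-k , root

  field
    tree           : EdgeSet k n
    isArborescence : IsArborescence constellation rootVertex tree

VertexLabelling : ∀ {k n} → Constellation k n → (Fin k → ℕ) → Set
VertexLabelling C p =
  ∀ t → Bijection (Constellation.verticesOfType C t) (setoid (Fin (p t)))

module _ {k n} {C : Constellation k n} {p : Fin k → ℕ} (L : VertexLabelling C p) where

  -- The label of the vertex of type t incident to the hyperedge h.
  vertexLabel : ∀ t → Fin n → Fin (p t)
  vertexLabel t = Bijection.to (L t)

  -- The hyperdegree of the vertex of type t labelled i.
  hyperdegree : ∀ t → Fin (p t) → ℕ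
  hyperdegree t i = Vec.count (λ h → vertexLabel t h ≟ i) (Vec.allFin n)

------------------------------------------------------------------------
-- Vertex-labelled tree-rooted constellations of given vertex-compositions

record LabelledTreeRooted {k n : ℕ} .{{_ : NonTrivial k}}
                          (γ : Fin k → Composition n) : Set where
  field
    treeRooted : TreeRootedConstellation k n

  open TreeRootedConstellation treeRooted public

  field
    labelling          : VertexLabelling constellation (λ t → ℓ (γ t))
    vertexCompositions : ∀ t i → hyperdegree {C = constellation} labelling t i ≡ part (γ t) i

  label : ∀ t → Fin n → Fin (ℓ (γ t))
  label = vertexLabel {C = constellation} labelling

module _ {k n : ℕ} .{{_ : NonTrivial k}} {γ : Fin k → Composition n} where

  -- Equality up to relabelling of the hyperedges.
  record _≅_ (T T′ : LabelledTreeRooted γ) : Set where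
    private
      module T  = LabelledTreeRooted T
      module T′ = LabelledTreeRooted T′
    field
      σ               : Permutation′ n
      preserves-π     : ∀ t h → σ ⟨$⟩ʳ (T.π t ⟨$⟩ʳ h) ≡ T′.π t ⟨$⟩ʳ (σ ⟨$⟩ʳ h)
      preserves-root  : σ ⟨$⟩ʳ T.root ≡ T′.root
      preserves-label : ∀ t h → T.label t h ≡ T′.label t (σ ⟨$⟩ʳ h)
      preserves-tree  : ∀ t h → (t , h) ∈ₑ T.tree ⇔ (t , σ ⟨$⟩ʳ h) ∈ₑ T′.tree

  ≅-refl : ∀ {T} → T ≅ T
  ≅-refl = record
    { σ               = Perm.id
    ; preserves-π     = λ _ _ → refl
    ; preserves-root  = refl
    ; preserves-label = λ _ _ → refl
    ; preserves-tree  = λ _ _ → mk⇔ (λ x → x) (λ x → x)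
    }

  ≅-sym : ∀ {T T′} → T ≅ T′ → T′ ≅ T
  ≅-sym {T} {T′} iso = record
    { σ               = flip σ
    ; preserves-π     = λ t h → begin
        σ⁻¹ (T′.π t ⟨$⟩ʳ h)                ≡⟨ cong (λ x → σ⁻¹ (T′.π t ⟨$⟩ʳ x)) (Perm.inverseʳ σ) ⟨
        σ⁻¹ (T′.π t ⟨$⟩ʳ (σ ⟨$⟩ʳ σ⁻¹ h))   ≡⟨ cong σ⁻¹ (preserves-π t (σ⁻¹ h)) ⟨
        σ⁻¹ (σ ⟨$⟩ʳ (T.π t ⟨$⟩ʳ σ⁻¹ h))    ≡⟨ Perm.inverseˡ σ ⟩
        T.π t ⟨$⟩ʳ σ⁻¹ h                   ∎
    ; preserves-root  = trans (cong σ⁻¹ (sym preserves-root)) (Perm.inverseˡ σ)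
    ; preserves-label = λ t h →
        sym (trans (preserves-label t (σ⁻¹ h)) (cong (T′.label t) (Perm.inverseʳ σ)))
    ; preserves-tree  = λ t h → mk⇔
        (λ x → Equivalence.from (preserves-tree t (σ⁻¹ h))
                 (subst (λ y → (t , y) ∈ₑ T′.tree) (sym (Perm.inverseʳ σ)) x))
        (λ x → subst (λ y → (t , y) ∈ₑ T′.tree) (Perm.inverseʳ σ)
                 (Equivalence.to (preserves-tree t (σ⁻¹ h)) x))
    }
    where
    open _≅_ iso
    open ≡-Reasoning
    module T  = LabelledTreeRooted T
    module T′ = LabelledTreeRooted T′
    σ⁻¹ = flip σ ⟨$⟩ʳ_

  ≅-trans : ∀ {T T′ T″} → T ≅ T′ → T′ ≅ T″ → T ≅ T″
  ≅-trans f g = record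
    { σ               = F.σ ∘ₚ G.σ
    ; preserves-π     = λ t h →
        trans (cong (G.σ ⟨$⟩ʳ_) (F.preserves-π t h)) (G.preserves-π t _)
    ; preserves-root  = trans (cong (G.σ ⟨$⟩ʳ_) F.preserves-root) G.preserves-root
    ; preserves-label = λ t h → trans (F.preserves-label t h) (G.preserves-label t _)
    ; preserves-tree  = λ t h → mk⇔
        (λ x → Equivalence.to (G.preserves-tree t _) (Equivalence.to (F.preserves-tree t h) x))
        (λ x → Equivalence.from (F.preserves-tree t h) (Equivalence.from (G.preserves-tree t _) x))
    }
    where
    module F = _≅_ f
    module G = _≅_ g

𝒯 : ∀ {k n} .{{_ : NonTrivial k}} → (Fin k → Composition n) → Setoid 0ℓ 0ℓ
𝒯 γ = record
  { Carrier       = LabelledTreeRooted γ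
  ; _≈_           = _≅_
  ; isEquivalence = record { refl = ≅-refl ; sym = ≅-sym ; trans = ≅-trans }
  }

{-# OPTIONS --safe #-}
module Submission where

-- Mark at every vertex one incident hyperedge: the one whose edge of the vertex's type lies in the tree, or the
-- root hyperedge at the root vertex. A cycle with a marked element is a linear order, so a tree-rooted
-- constellation amounts to an arrangement, for each type t, of the hyperedges on a fixed set of positions cut
-- into blocks, the first position of each block carrying the mark, such that from every hyperedge the walk
-- "go to the next type, then to the mark of the block" leads to the root. The number of marked positions depends
-- only on the length of the composition, so it suffices to move one unmarked position from a block i to a block j.
-- Let s be the hyperedge on it and x, y the marks of i and j. If the walk from y does not pass through s, the same
-- arrangement still satisfies the tree condition. If it does, then the move would close a cycle through y, and
-- exchanging x and y repairs it: now y is in block i, x in block j, the mark of the block of s is again x, and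
-- every mark still leads to the root. The same rule, applied to the move from j to i, is inverse to this one.

open import Defs
open import Data.Bool.Base using (true; false)
open import Data.Empty using (⊥-elim)
open import Data.Fin.Base as Fin using (Fin; toℕ; fromℕ<)
open import Data.Fin.Permutation as Perm using (Permutation′; _⟨$⟩ʳ_; _⟨$⟩ˡ_; _∘ₚ_; flip)
import Data.Fin.Permutation.Components as PC
import Data.Fin.Properties as Fin
open import Data.Fin.Subset using () renaming (_∈_ to _∈ₛ_)
open import Data.List.Base using (List; []; _∷_; map; concatMap; allFin; length; lookup; filter; applyUpTo; tabulate)
open import Data.List.Membership.Propositional using (_∈_; _∉_; lose)
open import Data.List.Membership.Propositional.Properties using (∈-concatMap⁺; ∈-map⁺; ∈-allFin; ∈-applyUpTo⁺; ∈-applyUpTo⁻; ∈-filter⁺; ∈-filter⁻; ∈-lookup)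
open import Data.List.Membership.Propositional.Properties.WithK using (unique∧set⇒bag)
open import Data.List.Properties using (length-applyUpTo)
open import Data.List.Relation.Binary.BagAndSetEquality using (∼bag⇒↭)
open import Data.List.Relation.Binary.Permutation.Propositional.Properties using (↭-length)
import Data.List.Relation.Unary.All as All
open import Data.List.Relation.Unary.All using (All; []; _∷_)
import Data.List.Relation.Unary.All.Properties as All
open import Data.List.Relation.Unary.AllPairs using (_∷_)
open import Data.List.Relation.Unary.Any using (here; there)
open import Data.List.Relation.Unary.Unique.Propositional using (Unique)
import Data.List.Relation.Unary.Unique.Propositional.Properties as Unique
open import Data.Nat.Base
open import Data.Nat.DivMod using (_%_; _/_; m≡m%n+[m/n]*n; m%n<n; m<n⇒m%n≡m; [m+n]%n≡m%n; n%n≡0)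
open import Data.Nat.GeneralisedArithmetic using (fold; fold-+)
open import Data.Nat.Induction using (<-rec)
open import Data.Nat.ListAction using (sum)
open import Data.Nat.Properties using (anyUpTo?; +-comm; +-assoc; +-suc; m∸n+n≡m; m+n∸m≡n; +-monoʳ-<; <-≤-trans; ≤-trans; ≤-refl; ≤-reflexive; <⇒≤; <⇒≢; <-irrefl; <-cmp; <-trans; n<1+n; 1+n≢n; n≮0; m≤m+n; m≤n⇒∃[o]m+o≡n; m≤n⇒m<n∨m≡n; suc-injective; suc-pred)
open import Data.Product.Base using (Σ; _×_; _,_; ∃; ∃₂; proj₁; proj₂)
open import Data.Product.Properties using (≡-dec)
open import Data.Sum.Base using (_⊎_; inj₁; inj₂; [_,_]′) renaming (map to map-⊎)
open import Data.Sum.Function.Propositional using (_⊎-↔_)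
open import Data.Unit.Base using (⊤)
import Data.Vec.Base as Vec
import Data.Vec.Properties as Vec
open import Function.Base using (_∘_; id; const; case_of_)
open import Function.Bundles using (Bijection; Inverse; Injection; Equivalence; _↔_; _↣_; _⇔_; mk⇔; mk↔ₛ′)
open import Function.Construct.Composition using (bijection; _↔-∘_)
open import Function.Construct.Identity using (↔-id)
open import Function.Properties.Inverse using (↔⇒↣; ↔-sym)
open import Level using (0ℓ)
open import Relation.Binary.Bundles using (Setoid)
open import Relation.Binary.Definitions using (DecidableEquality; tri<; tri≈; tri>)
open import Relation.Binary.PropositionalEquality hiding (setoid)
open import Relation.Binary.Structures using (IsEquivalence)
open import Relation.Nullary using (¬_; Dec; yes; no; does; contradiction)
open import Relation.Nullary.Decidable using (_×-dec_; ¬?; dec-true)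
open import Relation.Unary using (Pred; Decidable)

open Inverse using (to; from; strictlyInverseˡ; strictlyInverseʳ)

module _ (S T : Setoid 0ℓ 0ℓ) where
  open Setoid S renaming (Carrier to A; _≈_ to _≈₁_) using ()
  open Setoid T renaming (Carrier to B; _≈_ to _≈₂_) using ()

  -- All bijections below are given as relations, so that compatibility with isomorphism and
  -- invertibility can be read off from what characterises related objects, not from the functions
  -- constructing them.
  correspondence⇒Bijection :
    (R : A → B → Set) → (∀ a → ∃ (R a)) → (∀ b → ∃ λ a → R a b) →
    (∀ {a a′ b b′} → R a b → R a′ b′ → a ≈₁ a′ → b ≈₂ b′) →
    (∀ {a a′ b b′} → R a b → R a′ b′ → b ≈₂ b′ → a ≈₁ a′) →
    Bijection S T
  correspondence⇒Bijection R total total⁻¹ cong→ cong← = record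
    { to        = λ a → proj₁ (total a)
    ; cong      = cong→ (proj₂ (total _)) (proj₂ (total _))
    ; bijective = cong← (proj₂ (total _)) (proj₂ (total _))
                , λ b → proj₁ (total⁻¹ b) , cong→ (proj₂ (total _)) (proj₂ (total⁻¹ b))
    }

-- Iteration and functional graphs

least : ∀ {P : Pred ℕ 0ℓ} → Decidable P → ∀ n → P n → ∃ λ m → P m × (∀ {x} → x < m → ¬ P x)
least {P} P? = <-rec (λ n → P n → ∃ λ m → P m × (∀ {x} → x < m → ¬ P x)) λ n rec p →
  case anyUpTo? P? n of λ where
    (yes (m , m<n , q)) → rec m<n q
    (no ¬below)         → n , p , λ x<n px → ¬below (_ , x<n , px)

-- `c` is the exact period: `f` descends to an injective function on the residues modulo `c`.
record HasPeriod {X : Set} (f : ℕ → X) (c : ℕ) : Set where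
  field
    0<period  : 0 < c
    periodic  : ∀ x → f (x + c) ≡ f x
    injective : ∀ {x y} → x < c → y < c → f x ≡ f y → x ≡ y

open HasPeriod

reduce : ∀ {X : Set} {f : ℕ → X} {c} → (∀ x → f (x + suc c) ≡ f x) → ∀ x → f x ≡ f (x % suc c)
reduce {f = f} {c} per x = trans (cong f (m≡m%n+[m/n]*n x (suc c))) (shift (x % suc c) (x / suc c))
  where
  shift : ∀ y z → f (y + z * suc c) ≡ f y
  shift y zero    = cong f (+-comm y 0)
  shift y (suc z) = begin
    f (y + (suc c + z * suc c))  ≡⟨ cong (λ u → f (y + u)) (+-comm (suc c) (z * suc c)) ⟩
    f (y + (z * suc c + suc c))  ≡⟨ cong f (+-assoc y (z * suc c) (suc c)) ⟨
    f (y + z * suc c + suc c)    ≡⟨ per (y + z * suc c) ⟩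
    f (y + z * suc c)            ≡⟨ shift y z ⟩
    f y                          ∎
    where open ≡-Reasoning

-- Equal values of `f` have congruent arguments modulo `c`, so any `c`-periodic `g` is a function of
-- `f`.
same-period : ∀ {X Y : Set} {f : ℕ → X} {c} → HasPeriod f c →
              (g : ℕ → Y) → (∀ x → g (x + c) ≡ g x) → ∀ x y → f x ≡ f y → g x ≡ g y
same-period {c = zero} p _ _ _ _ _ = contradiction (0<period p) n≮0
same-period {c = suc c} p g q x y eq = begin
  g x            ≡⟨ reduce q x ⟩
  g (x % suc c)  ≡⟨ cong g (injective p (m%n<n x (suc c)) (m%n<n y (suc c))
                      (trans (sym (reduce (periodic p) x)) (trans eq (reduce (periodic p) y)))) ⟩
  g (y % suc c)  ≡⟨ reduce q y ⟨
  g y            ∎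
  where open ≡-Reasoning

shift-HasPeriod : ∀ {X : Set} {f : ℕ → X} {c} → HasPeriod f c → HasPeriod (f ∘ suc) c
shift-HasPeriod {f = f} {zero}  p = contradiction (0<period p) n≮0
shift-HasPeriod {f = f} {suc c} p = record
  { 0<period  = 0<period p
  ; periodic  = periodic p ∘ suc
  -- Equal values at `suc x` and `suc y` remain equal `c` steps later, and that is one full period
  -- after `x` and `y`.
  ; injective = λ {x} {y} x< y< eq → injective p x< y< (begin
      f x            ≡⟨ periodic p x ⟨
      f (x + suc c)  ≡⟨ cong f (+-suc x c) ⟩
      f (suc x + c)  ≡⟨ same-period p (λ z → f (z + c)) (per c) (suc x) (suc y) eq ⟩
      f (suc y + c)  ≡⟨ cong f (+-suc y c) ⟨
      f (y + suc c)  ≡⟨ periodic p y ⟩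
      f y            ∎)
  }
  where
  open ≡-Reasoning
  per : ∀ d z → f (z + suc c + d) ≡ f (z + d)
  per d z = trans (cong f (trans (+-assoc z (suc c) d)
    (trans (cong (z +_) (+-comm (suc c) d)) (sym (+-assoc z d (suc c)))))) (periodic p (z + d))

module _ {A : Set} (f : A → A) where

  fold-shift : ∀ v m → fold (f v) f m ≡ f (fold v f m)
  fold-shift v zero    = refl
  fold-shift v (suc m) = cong f (fold-shift v m)

  -- A repetition at times `x < y` would, after `c ∸ y` further steps, bring the orbit to `z` at the
  -- time `c ∸ y + x`, which is positive and below `c`. Time 0 is exempt, so `v` may equal `z`.
  distinct-before : ∀ {v z c} → fold v f c ≡ z → (∀ {x} → 0 < x → x < c → fold v f x ≢ z) →
                    ∀ {x y} → 0 < x → x < y → y ≤ c → fold v f x ≢ fold v f y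
  distinct-before {v} {z} {c} hit first {x} {y} 0<x x<y y≤c eq =
    first (<-≤-trans 0<x (≤-trans (m≤m+n x _) (≤-reflexive (+-comm x _)))) lt (begin
      fold v f (c ∸ y + x)           ≡⟨ fold-+ v f (c ∸ y) ⟩
      fold (fold v f x) f (c ∸ y)    ≡⟨ cong (λ u → fold u f (c ∸ y)) eq ⟩
      fold (fold v f y) f (c ∸ y)    ≡⟨ fold-+ v f (c ∸ y) ⟨
      fold v f (c ∸ y + y)           ≡⟨ cong (fold v f) (m∸n+n≡m y≤c) ⟩
      fold v f c                     ≡⟨ hit ⟩
      z                              ∎)
    where
    open ≡-Reasoning
    lt : c ∸ y + x < c
    lt = <-≤-trans (+-monoʳ-< (c ∸ y) x<y) (≤-reflexive (m∸n+n≡m y≤c))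

  module _ (_≟_ : DecidableEquality A) where

    orbit-period : ∀ e d → fold e f (suc d) ≡ e → ∃ (HasPeriod (fold e f))
    orbit-period e d ret with least (λ x → fold e f (suc x) ≟ e) d ret
    ... | c , hit , first = suc c , record
      { 0<period  = z<s
      ; periodic  = λ x → trans (fold-+ e f x) (cong (λ u → fold u f x) hit)
      ; injective = inj
      }
      where
      distinct : ∀ {x y} → x < y → y < suc c → fold e f x ≢ fold e f y
      -- Both times are raised by one, because time 0 sits at `e` itself and is exempt in
      -- `distinct-before`.
      distinct x<y y<1+c eq = distinct-before hit first′ z<s (s<s x<y) y<1+c (cong f eq)
        where
        first′ : ∀ {x} → 0 < x → x < suc c → fold e f x ≢ e
        first′ {suc x} _ lt = first (s≤s⁻¹ lt)
      inj : ∀ {x y} → x < suc c → y < suc c → fold e f x ≡ fold e f y → x ≡ y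
      inj {x} {y} x< y< eq with <-cmp x y
      ... | tri< x<y _ _ = contradiction eq (distinct x<y y<)
      ... | tri≈ _ x≡y _ = x≡y
      ... | tri> _ _ y<x = contradiction (sym eq) (distinct y<x x<)

    eventually-periodic : ∀ {N} → A ↣ Fin N → ∀ v → ∃₂ λ x d → fold (fold v f x) f (suc d) ≡ fold v f x
    eventually-periodic {N} emb v
      with i , j , i<j , eq ← Fin.pigeonhole (n<1+n N) (λ i → Injection.to emb (fold v f (toℕ i)))
      with d , 1+i+d≡j ← m≤n⇒∃[o]m+o≡n i<j
      = toℕ i , d , (begin
        fold (fold v f (toℕ i)) f (suc d)  ≡⟨ fold-+ v f (suc d) ⟨
        fold v f (suc d + toℕ i)           ≡⟨ cong (λ u → fold v f (suc u)) (+-comm d (toℕ i)) ⟩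
        fold v f (suc (toℕ i) + d)         ≡⟨ cong (fold v f) 1+i+d≡j ⟩
        fold v f (toℕ j)                   ≡⟨ Injection.injective emb eq ⟨
        fold v f (toℕ i)                   ∎)
      where open ≡-Reasoning

module FunctionalGraph {A : Set} (_≟_ : DecidableEquality A) where

  -- The walk halts at its first arrival at `r`, whatever `P r` is. The side condition in `step`
  -- makes all derivations for `v` equally long, so that `depth` is a function of `v`.
  data Reach (P : A → A) (r : A) (v : A) : Set where
    here : v ≡ r → Reach P r v
    step : v ≢ r → Reach P r (P v) → Reach P r v

  module _ {P : A → A} {r : A} where

    iterate-Reach : ∀ m {v} → fold v P m ≡ r → Reach P r v
    iterate-Reach zero    eq = here eq
    iterate-Reach (suc m) {v} eq with v ≟ r
    ... | yes v≡r = here v≡r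
    ... | no  v≢r = step v≢r (iterate-Reach m (trans (fold-shift P v m) eq))

    pull-Reach : ∀ m {v} → Reach P r (fold v P m) → Reach P r v
    pull-Reach zero    ρ = ρ
    pull-Reach (suc m) {v} ρ with v ≟ r
    ... | yes v≡r = here v≡r
    ... | no  v≢r = step v≢r (pull-Reach m (subst (Reach P r) (sym (fold-shift P v m)) ρ))

    depth : ∀ {v} → Reach P r v → ℕ
    depth (here _)   = 0
    depth (step _ ρ) = suc (depth ρ)

    depth-unique : ∀ {v} (ρ ρ′ : Reach P r v) → depth ρ ≡ depth ρ′
    depth-unique (here _)   (here _)    = refl
    depth-unique (here eq)  (step ≢r _) = contradiction eq ≢r
    depth-unique (step ≢r _) (here eq)  = contradiction eq ≢r
    depth-unique (step _ ρ) (step _ ρ′) = cong suc (depth-unique ρ ρ′)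

    hitting-time : ∀ {v} → Reach P r v →
                   ∃ λ c → fold v P c ≡ r × (∀ {x} → x < c → fold v P x ≢ r)
    hitting-time ρ = least (λ m → fold _ P m ≟ r) (depth ρ) (hits ρ)
      where
      hits : ∀ {v} (ρ : Reach P r v) → fold v P (depth ρ) ≡ r
      hits (here eq)      = eq
      hits {v} (step _ ρ) = trans (sym (fold-shift P v (depth ρ))) (hits ρ)

    -- In a finite set every orbit runs into a cycle, which either contains `r` or misses it.
    Reach-or-cycle : ∀ {N} → A ↣ Fin N → ∀ v → Reach P r v ⊎
      ∃₂ λ x c → HasPeriod (fold (fold v P x) P) c × (∀ {y} → y < c → fold (fold v P x) P y ≢ r)
    Reach-or-cycle emb v
      with x , d , ret ← eventually-periodic P _≟_ emb v
      with c , per ← orbit-period P _≟_ (fold v P x) d ret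
      with anyUpTo? (λ y → fold (fold v P x) P y ≟ r) c
    ... | yes (y , _ , hit) = inj₁ (pull-Reach x (iterate-Reach y hit))
    ... | no ¬hit           = inj₂ (x , c , per , λ y<c hit → ¬hit (_ , y<c , hit))

  Reach-map : ∀ {P P′ : A → A} {r r′ : A} (f : A → A) → (∀ {u v} → f u ≡ f v → u ≡ v) →
              f r ≡ r′ → (∀ v → f (P v) ≡ P′ (f v)) → ∀ {v} → Reach P r v → Reach P′ r′ (f v)
  Reach-map f inj fr fP (here v≡r) = here (trans (cong f v≡r) fr)
  Reach-map {P′ = P′} {r′ = r′} f inj fr fP (step v≢r ρ) =
    step (λ eq → v≢r (inj (trans eq (sym fr)))) (subst (Reach P′ r′) (fP _) (Reach-map f inj fr fP ρ))

  -- Only points strictly before the arrival at `r` count, since no step is taken from `r`.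
  data Visits (P : A → A) (r : A) (U : A → Set) (v : A) : Set where
    hit  : v ≢ r → U v → Visits P r U v
    pass : v ≢ r → Visits P r U (P v) → Visits P r U v

  module _ {P : A → A} {r : A} {U : A → Set} where

    Visits-v≢r : ∀ {v} → Visits P r U v → v ≢ r
    Visits-v≢r (hit ≢r _)  = ≢r
    Visits-v≢r (pass ≢r _) = ≢r

    Visits? : Decidable U → ∀ {v} → Reach P r v → Dec (Visits P r U v)
    Visits? U? (here v≡r) = no (λ vis → Visits-v≢r vis v≡r)
    Visits? U? {v} (step v≢r ρ) with U? v | Visits? U? ρ
    ... | yes u | _      = yes (hit v≢r u)
    ... | no _  | yes vs = yes (pass v≢r vs)
    ... | no ¬u | no ¬vs = no λ where
      (hit _ u)   → ¬u u
      (pass _ vs) → ¬vs vs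

    Visits-≐ : ∀ {P′ : A → A} {U′ : A → Set} → (∀ v → P v ≡ P′ v) → (∀ {v} → U v → U′ v) →
               ∀ {v} → Visits P r U v → Visits P′ r U′ v
    Visits-≐ eq sub (hit ≢r u)   = hit ≢r (sub u)
    Visits-≐ {P′} {U′} eq sub (pass ≢r vs) = pass ≢r (subst (Visits P′ r U′) (eq _) (Visits-≐ eq sub vs))

  Visits-map : ∀ {P P′ : A → A} {r r′ : A} {U U′ : A → Set} (f : A → A) →
               (∀ {u v} → f u ≡ f v → u ≡ v) → f r ≡ r′ → (∀ v → f (P v) ≡ P′ (f v)) →
               (∀ {v} → U v → U′ (f v)) → ∀ {v} → Visits P r U v → Visits P′ r′ U′ (f v)
  Visits-map f inj fr fP fU (hit ≢r u)   = hit (λ eq → ≢r (inj (trans eq (sym fr)))) (fU u)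
  Visits-map {P′ = P′} {r′ = r′} {U′ = U′} f inj fr fP fU (pass ≢r vs) =
    pass (λ eq → ≢r (inj (trans eq (sym fr)))) (subst (Visits P′ r′ U′) (fP _) (Visits-map f inj fr fP fU vs))

  module Rewire {P : A → A} {r : A} (reach : ∀ v → Reach P r v)
                {U : A → Set} (U? : Decidable U) {a b : A} (P-U : ∀ {v} → U v → P v ≡ a) where

    d : A → ℕ
    d v = depth (reach v)

    d-step : ∀ {v} → v ≢ r → d (P v) < d v
    d-step {v} ≢r = ≤-reflexive (depth-unique (step ≢r (reach (P v))) (reach v))

    -- Right after a point of `U` the walk is at `a`, strictly closer to the root than where it
    -- started.
    Visits-d : ∀ {v} → Visits P r U v → d a < d v
    Visits-d (hit ≢r u) = subst (λ z → d z < _) (P-U u) (d-step ≢r)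
    Visits-d (pass ≢r vs) = <-trans (Visits-d vs) (d-step ≢r)

    module Redirect {P′ : A → A} (off : ∀ {v} → ¬ U v → P′ v ≡ P v) (on : ∀ {v} → U v → P′ v ≡ b)
                    (¬vs : ¬ Visits P r U b) where

      -- The walk from `b` avoids `U` and so survives; any other walk either survives too or is led
      -- to `b` by its first step out of `U`.
      reach′ : ∀ v → Reach P′ r v
      reach′ v = go (reach v)
        where
        avoid : ∀ {v} → Reach P r v → ¬ Visits P r U v → Reach P′ r v
        avoid (here eq) _ = here eq
        avoid {v} (step ≢r ρ) ¬vs with U? v
        ... | yes u = contradiction (hit ≢r u) ¬vs
        ... | no ¬u = step ≢r (subst (Reach P′ r) (sym (off ¬u)) (avoid ρ (¬vs ∘ pass ≢r)))
        go : ∀ {v} → Reach P r v → Reach P′ r v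
        go (here eq) = here eq
        go {v} (step ≢r ρ) with U? v
        ... | yes u = step ≢r (subst (Reach P′ r) (sym (on u)) (avoid (reach b) ¬vs))
        ... | no ¬u = step ≢r (subst (Reach P′ r) (sym (off ¬u)) (go ρ))

      -- Up to its first point of `U` a walk of `P′` is a walk of `P`, so a visit from `a` would
      -- place `a` strictly below its own depth. Hence the reverse move needs no exchange either.
      ¬Visits′ : ¬ Visits P′ r U a
      ¬Visits′ vs = <-irrefl refl (Visits-d (back vs))
        where
        back : ∀ {v} → Visits P′ r U v → Visits P r U v
        back (hit ≢r u) = hit ≢r u
        back {v} (pass ≢r vs) with U? v
        ... | yes u = hit ≢r u
        ... | no ¬u = pass ≢r (subst (Visits P r U) (off ¬u) (back vs))

    -- Along b → … → a → … → r only the steps in U enter a or b (otherwise the depth d would not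
    -- decrease), so this path survives, and every other vertex still runs into it.
    module Exchange {P′ : A → A} (off : ∀ {v} → P v ≢ a → P v ≢ b → P′ v ≡ P v)
                    (on : ∀ {v} → U v → P′ v ≡ a)
                    (near : ∀ v → P′ v ≡ P v ⊎ P′ v ≡ a ⊎ P′ v ≡ b)
                    (vs : Visits P r U b) where

      d-a<d-b : d a < d b
      d-a<d-b = Visits-d vs

      smaller⇒≢ : ∀ {u v} → d u < d v → u ≢ v
      smaller⇒≢ lt refl = <-irrefl refl lt

      below-a : ∀ {v} → Reach P r v → d v ≤ d a → Reach P′ r v
      below-a (here eq) _ = here eq
      below-a {v} (step ≢r ρ) v≤a =
        step ≢r (subst (Reach P′ r) (sym (off (smaller⇒≢ lt) (smaller⇒≢ (<-trans lt d-a<d-b))))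
          (below-a ρ (<⇒≤ lt)))
        where
        lt : d (P v) < d a
        lt = <-≤-trans (d-step ≢r) v≤a

      a-reach : Reach P′ r a
      a-reach = below-a (reach a) ≤-refl

      keep : ∀ {v} → v ≢ r → Visits P r U (P v) → d v ≤ d b → P′ v ≡ P v
      keep ≢r vs v≤b =
        off (≢-sym (smaller⇒≢ (Visits-d vs))) (smaller⇒≢ (<-≤-trans (d-step ≢r) v≤b))

      below-b : ∀ {v} → Visits P r U v → d v ≤ d b → Reach P′ r v
      below-b (hit ≢r u) _ = step ≢r (subst (Reach P′ r) (sym (on u)) a-reach)
      below-b (pass ≢r vs) v≤b = step ≢r (subst (Reach P′ r) (sym (keep ≢r vs v≤b))
        (below-b vs (<⇒≤ (<-≤-trans (d-step ≢r) v≤b))))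

      b-reach : Reach P′ r b
      b-reach = below-b vs ≤-refl

      reach′ : ∀ v → Reach P′ r v
      reach′ v = go (reach v)
        where
        go : ∀ {v} → Reach P r v → Reach P′ r v
        go (here eq) = here eq
        go {v} (step ≢r ρ) with near v
        ... | inj₁ eq        = step ≢r (subst (Reach P′ r) (sym eq) (go ρ))
        ... | inj₂ (inj₁ eq) = step ≢r (subst (Reach P′ r) (sym eq) a-reach)
        ... | inj₂ (inj₂ eq) = step ≢r (subst (Reach P′ r) (sym eq) b-reach)

      -- The part of the old path from `b` up to `U` is intact. This makes the reverse move
      -- obstructed as well, so that it exchanges again.
      Visits′ : Visits P′ r U b
      Visits′ = go vs ≤-refl
        where
        go : ∀ {v} → Visits P r U v → d v ≤ d b → Visits P′ r U v
        go (hit ≢r u) _ = hit ≢r u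
        go (pass ≢r vs) v≤b = pass ≢r (subst (Visits P′ r U) (sym (keep ≢r vs v≤b))
          (go vs (<⇒≤ (<-≤-trans (d-step ≢r) v≤b))))

  -- `v` lies in the subtree hanging from `z`, the side of the tree that is cut off when the edge
  -- `z` is deleted.
  data Desc (P : A → A) (r z : A) (v : A) : Set where
    here : v ≡ z → Desc P r z v
    up   : v ≢ r → Desc P r z (P v) → Desc P r z v

  Desc-depth : ∀ {P r z v} (ρ : Reach P r z) (ρ′ : Reach P r v) → Desc P r z v → depth ρ ≤ depth ρ′
  Desc-depth ρ ρ′ (here refl) = ≤-reflexive (depth-unique ρ ρ′)
  Desc-depth ρ (here v≡r)  (up v≢r _) = contradiction v≡r v≢r
  Desc-depth ρ (step _ ρ′) (up _ δ)   = ≤-trans (Desc-depth ρ ρ′ δ) (<⇒≤ (n<1+n _))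

  -- Points of the subtree of `z` are at least as deep as `z`, and `P z` is shallower.
  parent-not-Desc : ∀ {P r z} → z ≢ r → Reach P r z → ¬ Desc P r z (P z)
  parent-not-Desc z≢r (here z≡r) δ = z≢r z≡r
  parent-not-Desc z≢r ρ@(step _ ρ′) δ = <-irrefl refl (Desc-depth ρ ρ′ δ)

-- Injectivity of bijections, and transpositions.

to-injective : ∀ {A B : Set} (w : A ↔ B) {x y} → to w x ≡ to w y → x ≡ y
to-injective w {x} {y} eq = trans (sym (strictlyInverseʳ w x)) (trans (cong (from w) eq) (strictlyInverseʳ w y))

to≡⇒≡from : ∀ {A B : Set} (w : A ↔ B) {x z} → to w x ≡ z → x ≡ from w z
to≡⇒≡from w {x} refl = sym (strictlyInverseʳ w x)

module Transpose {n} (x y : Fin n) where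

  τ : Fin n → Fin n
  τ = PC.transpose x y

  data View (h : Fin n) : Set where
    first  : h ≡ x → τ h ≡ y → View h
    second : h ≡ y → τ h ≡ x → View h
    other  : h ≢ x → h ≢ y → τ h ≡ h → View h

  view : ∀ h → View h
  view h with h Fin.≟ x in e₁
  ... | yes h≡x = first h≡x (eq e₁)
    where
    eq : (h Fin.≟ x) ≡ yes h≡x → τ h ≡ y
    eq e rewrite e = refl
  ... | no h≢x with h Fin.≟ y in e₂
  ...   | yes h≡y = second h≡y (eq e₁ e₂)
    where
    eq : (h Fin.≟ x) ≡ no h≢x → (h Fin.≟ y) ≡ yes h≡y → τ h ≡ x
    eq e f rewrite e | f = refl
  ...   | no h≢y = other h≢x h≢y (eq e₁ e₂)
    where
    eq : (h Fin.≟ x) ≡ no h≢x → (h Fin.≟ y) ≡ no h≢y → τ h ≡ h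
    eq e f rewrite e | f = refl

  τ-fixed : ∀ {h} → h ≢ x → h ≢ y → τ h ≡ h
  τ-fixed {h} ≢x ≢y with view h
  ... | first  h≡x _  = contradiction h≡x ≢x
  ... | second h≡y _  = contradiction h≡y ≢y
  ... | other  _ _ eq = eq

  τ-x : τ x ≡ y
  τ-x with view x
  ... | first  _ eq    = eq
  ... | second x≡y eq  = trans eq x≡y
  ... | other  ≢x _ _  = contradiction refl ≢x

  τ-y : τ y ≡ x
  τ-y with view y
  ... | first  y≡x eq  = trans eq y≡x
  ... | second _ eq    = eq
  ... | other  _ ≢y _  = contradiction refl ≢y

  τ-involutive : ∀ h → τ (τ h) ≡ h
  τ-involutive h with view h
  ... | first  h≡x eq  = trans (cong τ eq) (trans τ-y (sym h≡x))
  ... | second h≡y eq  = trans (cong τ eq) (trans τ-x (sym h≡y))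
  ... | other  _ _ eq  = trans (cong τ eq) eq

transpose-natural : ∀ {n} (f : Fin n → Fin n) → (∀ {u v} → f u ≡ f v → u ≡ v) →
                    ∀ x y h → PC.transpose (f x) (f y) (f h) ≡ f (PC.transpose x y h)
transpose-natural f inj x y h with Transpose.view x y h
... | Transpose.first  refl eq = trans (Transpose.τ-x (f x) (f y)) (cong f (sym eq))
... | Transpose.second refl eq = trans (Transpose.τ-y (f x) (f y)) (cong f (sym eq))
... | Transpose.other ≢x ≢y eq = trans (Transpose.τ-fixed (f x) (f y) (≢x ∘ inj) (≢y ∘ inj)) (cong f (sym eq))

-- Arrangements of hyperedges on blocks of positions

block : ∀ {p m} → (Fin m → Fin p) → Fin p ⊎ Fin m → Fin p
block b = [ id , b ]′

marker : ∀ {n p m} → (Fin m → Fin p) → Fin n ↔ (Fin p ⊎ Fin m) → Fin n → Fin n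
marker b w h = from w (inj₁ (block b (to w h)))

block-cong : ∀ {p m} {b b′ : Fin m → Fin p} → (∀ z → b z ≡ b′ z) → ∀ z → block b z ≡ block b′ z
block-cong eq (inj₁ _) = refl
block-cong eq (inj₂ z) = eq z

module _ {n p m : ℕ} where

  from-cong-on : ∀ (w w′ : Fin n ↔ (Fin p ⊎ Fin m)) (f : Fin n → Fin n) →
                 (∀ h → to w′ (f h) ≡ to w h) → ∀ z → f (from w z) ≡ from w′ z
  from-cong-on w w′ f eq z = to≡⇒≡from w′ (trans (eq _) (strictlyInverseˡ w z))

  marker-natural : ∀ {b b′ : Fin m → Fin p} (w w′ : Fin n ↔ (Fin p ⊎ Fin m)) (f : Fin n → Fin n) →
                   (∀ z → b z ≡ b′ z) → (∀ h → to w′ (f h) ≡ to w h) →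
                   ∀ h → f (marker b w h) ≡ marker b′ w′ (f h)
  marker-natural w w′ f b≗b′ eq h = trans (from-cong-on w w′ f eq _)
    (cong (from w′ ∘ inj₁) (trans (block-cong b≗b′ (to w h)) (cong (block _) (sym (eq h)))))

  marker-inj₁ : ∀ {b : Fin m → Fin p} (w : Fin n ↔ (Fin p ⊎ Fin m)) i → marker b w (from w (inj₁ i)) ≡ from w (inj₁ i)
  marker-inj₁ {b} w i = cong (from w ∘ inj₁ ∘ block b) (strictlyInverseˡ w (inj₁ i))

  marker-idem : ∀ {b : Fin m → Fin p} (w : Fin n ↔ (Fin p ⊎ Fin m)) h → marker b w (marker b w h) ≡ marker b w h
  marker-idem w h = marker-inj₁ w _

  module MoveSlot {b b′ : Fin m → Fin p} {q : Fin m} (agree : ∀ z → z ≢ q → b z ≡ b′ z)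
                  (w : Fin n ↔ (Fin p ⊎ Fin m)) where

    s x y : Fin n
    s = from w (inj₂ q)
    x = from w (inj₁ (b q))
    y = from w (inj₁ (b′ q))

    open Transpose x y

    marker-s : marker b w s ≡ x
    marker-s = cong (from w ∘ inj₁ ∘ block b) (strictlyInverseˡ w (inj₂ q))

    inj₁≢s : ∀ i → from w (inj₁ i) ≢ s
    inj₁≢s i eq with () ← trans (sym (strictlyInverseˡ w (inj₁ i)))
                            (trans (cong (to w) eq) (strictlyInverseˡ w (inj₂ q)))

    block-off : ∀ {h} → h ≢ s → block b′ (to w h) ≡ block b (to w h)
    block-off {h} h≢s with to w h in eq
    ... | inj₁ _ = refl
    ... | inj₂ z = sym (agree z λ z≡q → h≢s (to≡⇒≡from w (trans eq (cong inj₂ z≡q))))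

    -- New blocks `b′`, but still the arrangement `w`: this differs from `marker b w` at most at
    -- `s`.
    old : Fin n → Fin n
    old h = from w (inj₁ (block b′ (to w h)))

    old-off : ∀ {h} → h ≢ s → old h ≡ marker b w h
    old-off h≢s = cong (from w ∘ inj₁) (block-off h≢s)

    old-inj₁ : ∀ i → old (from w (inj₁ i)) ≡ from w (inj₁ i)
    old-inj₁ = marker-inj₁ {b = b′} w

    old-s : old s ≡ y
    old-s = cong (from w ∘ inj₁ ∘ block b′) (strictlyInverseˡ w (inj₂ q))

    module Same (w′ : Fin n ↔ (Fin p ⊎ Fin m)) (w′≗w : ∀ h → to w′ h ≡ to w h) where

      marker≗old : ∀ h → marker b′ w′ h ≡ old h
      marker≗old h = marker-natural w′ w id (λ _ → refl) (λ h → sym (w′≗w h)) h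

      off : ∀ {h} → h ≢ s → marker b′ w′ h ≡ marker b w h
      off h≢s = trans (marker≗old _) (old-off h≢s)

      on : marker b′ w′ s ≡ y
      on = trans (marker≗old s) old-s

    module Swapped (w′ : Fin n ↔ (Fin p ⊎ Fin m)) (w′≗wτ : ∀ h → to w′ h ≡ to w (τ h)) where

      from-τ : ∀ z → from w′ z ≡ τ (from w z)
      from-τ z = sym (from-cong-on w w′ τ
        (λ h → trans (w′≗wτ (τ h)) (cong (to w) (τ-involutive h))) z)

      -- Exchanging the occupants of two positions conjugates the map to the marks by `τ`.
      marker≗ : ∀ h → marker b′ w′ h ≡ τ (old (τ h))
      marker≗ h = trans (from-τ _) (cong (τ ∘ from w ∘ inj₁ ∘ block b′) (w′≗wτ h))

      from-s : from w′ (inj₂ q) ≡ s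
      from-s = trans (from-τ _) (τ-fixed (≢-sym (inj₁≢s _)) (≢-sym (inj₁≢s _)))

      from-x : from w′ (inj₁ (b′ q)) ≡ x
      from-x = trans (from-τ _) τ-y

      from-y : from w′ (inj₁ (b q)) ≡ y
      from-y = trans (from-τ _) τ-x

      off : ∀ {h} → marker b w h ≢ x → marker b w h ≢ y → marker b′ w′ h ≡ marker b w h
      off {h} ≢x ≢y = begin
        marker b′ w′ h   ≡⟨ marker≗ h ⟩
        τ (old (τ h))    ≡⟨ cong (τ ∘ old) (τ-fixed h≢x h≢y) ⟩
        τ (old h)        ≡⟨ cong τ (old-off h≢s) ⟩
        τ (marker b w h) ≡⟨ τ-fixed ≢x ≢y ⟩
        marker b w h     ∎
        where
        open ≡-Reasoning
        -- Each of `x`, `y` and `s` has mark `x` or `y`, so `h` is none of them.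
        h≢x : h ≢ x
        h≢x refl = ≢x (marker-inj₁ w _)
        h≢y : h ≢ y
        h≢y refl = ≢y (marker-inj₁ w _)
        h≢s : h ≢ s
        h≢s refl = ≢x marker-s

      on : marker b′ w′ s ≡ x
      on = begin
        marker b′ w′ s   ≡⟨ marker≗ s ⟩
        τ (old (τ s))    ≡⟨ cong (τ ∘ old) (τ-fixed (≢-sym (inj₁≢s _)) (≢-sym (inj₁≢s _))) ⟩
        τ (old s)        ≡⟨ cong τ old-s ⟩
        τ y              ≡⟨ τ-y ⟩
        x                ∎
        where open ≡-Reasoning

      near : ∀ h → marker b′ w′ h ≡ marker b w h ⊎ marker b′ w′ h ≡ x ⊎ marker b′ w′ h ≡ y
      near h with Transpose.view x y (old (τ h))
      ... | first  _ eq = inj₂ (inj₂ (trans (marker≗ h) eq))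
      ... | second _ eq = inj₂ (inj₁ (trans (marker≗ h) eq))
      ... | other ≢x ≢y eq = inj₁ (begin
        marker b′ w′ h     ≡⟨ trans (marker≗ h) eq ⟩
        old (τ h)          ≡⟨ old-off g≢s ⟩
        marker b w (τ h)   ≡⟨ cong (marker b w) τh≡h ⟩
        marker b w h       ∎)
        where
        open ≡-Reasoning
        -- The values of `old` at `s`, `x` and `y` are `y`, `x` and `y`. So `τ h` is none of the
        -- three, and `h` is fixed by `τ`.
        g≢s : τ h ≢ s
        g≢s g≡s = ≢y (trans (cong old g≡s) old-s)
        τh≡h : τ h ≡ h
        τh≡h = trans (sym (τ-fixed
          (λ g≡x → ≢x (trans (cong old g≡x) (old-inj₁ _)))
          (λ g≡y → ≢y (trans (cong old g≡y) (old-inj₁ _))))) (τ-involutive h)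

      -- The exchange only swaps the blocks that `x` and `y` mark, so every mark remains a mark; in
      -- particular the root does.
      fixed : ∀ {h} → marker b w h ≡ h → marker b′ w′ h ≡ h
      fixed {h} fix with Transpose.view x y h
      ... | first refl eq = trans (marker≗ h) (trans (cong τ (trans (cong old eq) (old-inj₁ _))) τ-y)
      ... | second refl eq = trans (marker≗ h) (trans (cong τ (trans (cong old eq) (old-inj₁ _))) τ-x)
      -- Here `h` is not `s` either: if `s` were its own mark, it would be `x`.
      ... | other ≢x ≢y eq = trans (marker≗ h) (trans (cong τ (trans (cong old eq)
              (trans (old-off λ { refl → ≢x (trans (sym fix) marker-s) }) fix))) eq)

-- Models: arrangements that satisfy the tree condition.

_≟ₑ_ : ∀ {k n} → DecidableEquality (Fin k × Fin n)
_≟ₑ_ = ≡-dec Fin._≟_ Fin._≟_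

module _ {k n : ℕ} where
  open FunctionalGraph (_≟ₑ_ {k} {n}) public

advance : ∀ {k n} .{{_ : NonTrivial k}} → Fin k × Fin n → Fin k × Fin n
advance (t , h) = next t , h

-- inj₁ i is the marked position of block i, and inj₂ z is an unmarked position of block b t z. A position of
-- a given type holds one hyperedge, and an edge (t , h) leads to the mark of the block of h in type next t.
record Model (k n : ℕ) .{{_ : NonTrivial k}} {p m : Fin k → ℕ} (b : ∀ t → Fin (m t) → Fin (p t)) : Set where
  field
    position : ∀ t → Fin n ↔ (Fin (p t) ⊎ Fin (m t))
    root     : Fin n

  mark : Fin k → Fin n → Fin n
  mark t = marker (b t) (position t)

  markₑ : Fin k × Fin n → Fin k × Fin n
  markₑ (t , h) = t , mark t h

  parent : Fin k × Fin n → Fin k × Fin n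
  parent v = markₑ (advance v)

  rootₑ : Fin k × Fin n
  rootₑ = type-k , root

  field
    root-marked : mark type-k root ≡ root
    reach       : ∀ v → Reach parent rootₑ v

module _ {k n : ℕ} .{{_ : NonTrivial k}} {p m : Fin k → ℕ} where

  -- The two block maps may differ, which lets `retag` compare models whose block maps agree only
  -- pointwise.
  record _≈ₘ_ {b b′ : ∀ t → Fin (m t) → Fin (p t)} (M : Model k n b) (N : Model k n b′) : Set where
    private
      module M = Model M
      module N = Model N
    field
      σ                  : Permutation′ n
      preserves-position : ∀ t h → to (N.position t) (σ ⟨$⟩ʳ h) ≡ to (M.position t) h
      preserves-root     : σ ⟨$⟩ʳ M.root ≡ N.root

  ≈ₘ-sym : ∀ {b b′ : ∀ t → Fin (m t) → Fin (p t)} {M : Model k n b} {N : Model k n b′} → M ≈ₘ N → N ≈ₘ M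
  ≈ₘ-sym {M = M} {N} iso = record
    { σ                  = flip σ
    ; preserves-position = λ t h → trans (sym (preserves-position t _))
                             (cong (to (Model.position N t)) (Perm.inverseʳ σ))
    ; preserves-root     = trans (cong (flip σ ⟨$⟩ʳ_) (sym preserves-root)) (Perm.inverseˡ σ)
    }
    where open _≈ₘ_ iso

  ≈ₘ-trans : ∀ {b b′ b″ : ∀ t → Fin (m t) → Fin (p t)} {L : Model k n b} {M : Model k n b′} {N : Model k n b″} →
             L ≈ₘ M → M ≈ₘ N → L ≈ₘ N
  ≈ₘ-trans f g = record
    { σ                  = F.σ ∘ₚ G.σ
    ; preserves-position = λ t h → trans (G.preserves-position t _) (F.preserves-position t h)
    ; preserves-root     = trans (cong (G.σ ⟨$⟩ʳ_) F.preserves-root) G.preserves-root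
    }
    where
    module F = _≈ₘ_ f
    module G = _≈ₘ_ g

  ℳ : (b : ∀ t → Fin (m t) → Fin (p t)) → Setoid 0ℓ 0ℓ
  ℳ b = record
    { Carrier       = Model k n b
    ; _≈_           = _≈ₘ_
    ; isEquivalence = record
      { refl  = record { σ = Perm.id ; preserves-position = λ _ _ → refl ; preserves-root = refl }
      ; sym   = ≈ₘ-sym
      ; trans = ≈ₘ-trans
      }
    }

  module Isomorphism {b b′ : ∀ t → Fin (m t) → Fin (p t)} {M : Model k n b} {N : Model k n b′}
                     (iso : M ≈ₘ N) where
    open _≈ₘ_ iso public
    private
      module M = Model M
      module N = Model N

    f : Fin n → Fin n
    f = σ ⟨$⟩ʳ_

    f-injective : ∀ {u v} → f u ≡ f v → u ≡ v
    f-injective = to-injective σ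

    fₑ : Fin k × Fin n → Fin k × Fin n
    fₑ (t , h) = t , f h

    fₑ-injective : ∀ {u v} → fₑ u ≡ fₑ v → u ≡ v
    fₑ-injective eq = cong₂ _,_ (cong proj₁ eq) (f-injective (cong proj₂ eq))

    preserves-from : ∀ t z → f (from (M.position t) z) ≡ from (N.position t) z
    preserves-from t = from-cong-on (M.position t) (N.position t) f (preserves-position t)

    preserves-rootₑ : fₑ M.rootₑ ≡ N.rootₑ
    preserves-rootₑ = cong (type-k ,_) preserves-root

    preserves-parent : (∀ t z → b t z ≡ b′ t z) → ∀ v → fₑ (M.parent v) ≡ N.parent (fₑ v)
    preserves-parent b≗b′ (t , h) = cong (next t ,_)
      (marker-natural (M.position _) (N.position _) f (b≗b′ _) (preserves-position _) h)

  -- Moving one unmarked position to another block.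

  module Step (b b′ : ∀ t → Fin (m t) → Fin (p t)) (t₀ : Fin k) (q : Fin (m t₀))
              (agree : ∀ {t} z → (t , z) ≢ (t₀ , q) → b t z ≡ b′ t z) where

    agree₀ : ∀ z → z ≢ q → b t₀ z ≡ b′ t₀ z
    agree₀ z z≢q = agree z λ { refl → z≢q refl }

    agree-off : ∀ {t} → t ≢ t₀ → ∀ z → b t z ≡ b′ t z
    agree-off t≢t₀ z = agree z (t≢t₀ ∘ cong proj₁)

    module Moved (M : Model k n b) where
      open Model M public
      open MoveSlot agree₀ (position t₀) public

      exchange : Fin k → Fin n → Fin n
      exchange t h with t Fin.≟ t₀
      ... | yes _ = PC.transpose x y h
      ... | no  _ = h

      exchange-on : ∀ h → exchange t₀ h ≡ PC.transpose x y h
      exchange-on h with t₀ Fin.≟ t₀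
      ... | yes _ = refl
      ... | no ≢  = contradiction refl ≢

      exchange-off : ∀ {t} → t ≢ t₀ → ∀ h → exchange t h ≡ h
      exchange-off {t} t≢t₀ h with t Fin.≟ t₀
      ... | yes t≡t₀ = contradiction t≡t₀ t≢t₀
      ... | no _     = refl

      exchange-involutive : ∀ t h → exchange t (exchange t h) ≡ h
      exchange-involutive t h with t Fin.≟ t₀
      ... | yes _ = Transpose.τ-involutive x y h
      ... | no  _ = refl

      a : Fin k × Fin n
      a = t₀ , x

      c : Fin k × Fin n
      c = t₀ , y

      -- The steps of the walk to the root that use s, and so change their end when s is moved.
      Moving : Fin k × Fin n → Set
      Moving v = advance v ≡ (t₀ , s)

      Moving? : ∀ v → Dec (Moving v)
      Moving? v = advance v ≟ₑ (t₀ , s)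

      parent-Moving : ∀ {v} → Moving v → parent v ≡ a
      parent-Moving eq = trans (cong markₑ eq) (cong (t₀ ,_) marker-s)

      Obstructed : Set
      Obstructed = Visits parent rootₑ Moving c

      Obstructed? : Dec Obstructed
      Obstructed? = Visits? Moving? (reach c)

      open Rewire reach Moving? {b = c} parent-Moving public

    -- The positions of `M′` are prescribed only pointwise, so that a model and the one obtained by
    -- moving there and back need not coincide as records.
    data Stepped (M : Model k n b) (M′ : Model k n b′) : Set where
      kept    : Model.root M′ ≡ Model.root M → ¬ Moved.Obstructed M →
                (∀ t h → to (Model.position M′ t) h ≡ to (Model.position M t) h) → Stepped M M′
      swapped : Model.root M′ ≡ Model.root M → Moved.Obstructed M →
                (∀ t h → to (Model.position M′ t) h ≡ to (Model.position M t) (Moved.exchange M t h)) →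
                Stepped M M′

    -- The new positions are a parameter: the same facts build the moved model in `total` and
    -- analyse a given one in `Stepped-sym`.
    module Arranged (M : Model k n b) (pos′ : ∀ t → Fin n ↔ (Fin (p t) ⊎ Fin (m t))) where
      open Moved M

      mark′ : Fin k → Fin n → Fin n
      mark′ t = marker (b′ t) (pos′ t)

      parent′ : Fin k × Fin n → Fin k × Fin n
      parent′ (t , h) = next t , mark′ (next t) h

      module Kept (eq : ∀ t h → to (pos′ t) h ≡ to (position t) h) (¬obs : ¬ Obstructed) where
        open Same (pos′ t₀) (eq t₀) renaming (off to off₀; on to on₀)

        mark′-off : ∀ t {h} → (t , h) ≢ (t₀ , s) → mark′ t h ≡ mark t h
        mark′-off t {h} ≢s = case t Fin.≟ t₀ of λ where
          (yes refl)  → off₀ (≢s ∘ cong (t₀ ,_))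
          (no  t≢t₀) → sym (marker-natural (position t) (pos′ t) id (agree-off t≢t₀) (eq t) h)

        on : ∀ {v} → Moving v → parent′ v ≡ c
        on {v} eq = trans (cong (λ (t , h) → t , mark′ t h) eq) (cong (t₀ ,_) on₀)

        open Redirect (λ {v} ¬mov → cong (next (proj₁ v) ,_) (mark′-off (next (proj₁ v)) ¬mov)) on ¬obs public

        root-marked′ : mark′ type-k root ≡ root
        root-marked′ = trans (mark′-off type-k ≢s) root-marked
          where
          -- The root is a mark, whereas `s` stands on an unmarked position.
          ≢s : rootₑ ≢ (t₀ , s)
          ≢s eq = inj₁≢s _ (begin
            x                  ≡⟨ cong proj₂ (parent-mark eq) ⟨
            mark type-k root   ≡⟨ root-marked ⟩
            root               ≡⟨ cong proj₂ eq ⟩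
            s                  ∎)
            where
            open ≡-Reasoning
            parent-mark : rootₑ ≡ (t₀ , s) → markₑ rootₑ ≡ a
            parent-mark eq = trans (cong markₑ eq) (cong (t₀ ,_) marker-s)

      module Swap (eq : ∀ t h → to (pos′ t) h ≡ to (position t) (exchange t h)) (obs : Obstructed) where
        open Swapped (pos′ t₀) (λ h → trans (eq t₀ h) (cong (to (position t₀)) (exchange-on h))) public
          using (from-s; from-x; from-y)
          renaming (off to off₀; on to on₀; near to near₀; fixed to fixed₀)

        mark′≗ : ∀ {t} → t ≢ t₀ → ∀ h → mark′ t h ≡ mark t h
        mark′≗ {t} t≢t₀ h = sym (marker-natural (position t) (pos′ t) id (agree-off t≢t₀)
          (λ h → trans (eq t h) (cong (to (position t)) (exchange-off t≢t₀ h))) h)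

        off : ∀ t {h} → (t , mark t h) ≢ a → (t , mark t h) ≢ c → mark′ t h ≡ mark t h
        off t ≢a ≢c = case t Fin.≟ t₀ of λ where
          (yes refl)  → off₀ (≢a ∘ cong (t₀ ,_)) (≢c ∘ cong (t₀ ,_))
          (no  t≢t₀) → mark′≗ t≢t₀ _

        on : ∀ {v} → Moving v → parent′ v ≡ a
        on {v} eq = trans (cong (λ (t , h) → t , mark′ t h) eq) (cong (t₀ ,_) on₀)

        near : ∀ t h → (t , mark′ t h) ≡ (t , mark t h) ⊎ (t , mark′ t h) ≡ a ⊎ (t , mark′ t h) ≡ c
        near t h = case t Fin.≟ t₀ of λ where
          (yes refl)  → map-⊎ (cong (t₀ ,_)) (map-⊎ (cong (t₀ ,_)) (cong (t₀ ,_))) (near₀ h)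
          (no  t≢t₀) → inj₁ (cong (t ,_) (mark′≗ t≢t₀ h))

        fixed : ∀ t {h} → mark t h ≡ h → mark′ t h ≡ h
        fixed t {h} fix = case t Fin.≟ t₀ of λ where
          (yes refl)  → fixed₀ fix
          (no  t≢t₀) → trans (mark′≗ t≢t₀ h) fix

        open Exchange {P′ = parent′}
          (λ {v} ≢a ≢c → cong (next (proj₁ v) ,_) (off (next (proj₁ v)) ≢a ≢c))
          on (λ (t , h) → near (next t) h) obs public

    total : ∀ M → ∃ (Stepped M)
    total M = case Obstructed? of λ where
        (no ¬obs) → let open Arranged M position
                        open Kept (λ _ _ → refl) ¬obs in
          record { position = position ; root = root ; root-marked = root-marked′ ; reach = reach′ }
          , kept refl ¬obs (λ _ _ → refl)
        (yes obs) → let open Arranged M position′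
                        open Swap (λ _ _ → refl) obs in
          record { position = position′ ; root = root ; root-marked = fixed type-k root-marked ; reach = reach′ }
          , swapped refl obs (λ _ _ → refl)
      where
      open Moved M
      position′ : ∀ t → Fin n ↔ (Fin (p t) ⊎ Fin (m t))
      position′ t = mk↔ₛ′ (to (position t) ∘ exchange t) (exchange t ∘ from (position t))
        (λ z → trans (cong (to (position t)) (exchange-involutive t _)) (strictlyInverseˡ (position t) z))
        (λ h → trans (cong (exchange t) (strictlyInverseʳ (position t) _)) (exchange-involutive t h))

  module _ {b b′ : ∀ t → Fin (m t) → Fin (p t)} {t₀ : Fin k} {q : Fin (m t₀)}
           (agree : ∀ {t} z → (t , z) ≢ (t₀ , q) → b t z ≡ b′ t z)
           (agree′ : ∀ {t} z → (t , z) ≢ (t₀ , q) → b′ t z ≡ b t z) where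
    private
      module S  = Step b b′ t₀ q agree
      module S′ = Step b′ b t₀ q agree′

    -- An isomorphism carries walks to walks, so isomorphic models fall under the same constructor
    -- of `Stepped`.
    Obstructed-map : ∀ {M N : Model k n b} → M ≈ₘ N → S.Moved.Obstructed M → S.Moved.Obstructed N
    Obstructed-map {M} {N} iso obs = subst (Visits _ _ _) (cong (t₀ ,_) (preserves-from t₀ _))
      (Visits-map fₑ fₑ-injective preserves-rootₑ (preserves-parent (λ _ _ → refl))
        (λ mov → trans (cong fₑ mov) (cong (t₀ ,_) (preserves-from t₀ _))) obs)
      where open Isomorphism iso

    Stepped-cong : ∀ {M N : Model k n b} {M′ N′ : Model k n b′} →
                   S.Stepped M M′ → S.Stepped N N′ → M ≈ₘ N → M′ ≈ₘ N′
    Stepped-cong {M} {N} {M′} {N′} s s′ iso = go s s′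
      where
      open Isomorphism iso
      go : S.Stepped M M′ → S.Stepped N N′ → M′ ≈ₘ N′
      go (S.kept r _ e) (S.kept r′ _ e′) = record
        { σ = σ
        ; preserves-position = λ t h → trans (e′ t _) (trans (preserves-position t h) (sym (e t h)))
        ; preserves-root = trans (cong f r) (trans preserves-root (sym r′))
        }
      go (S.swapped r _ e) (S.swapped r′ _ e′) = record
        { σ = σ
        ; preserves-position = λ t h → trans (e′ t _) (trans (cong (to (Model.position N t)) (nat t h))
            (trans (preserves-position t _) (sym (e t h))))
        ; preserves-root = trans (cong f r) (trans preserves-root (sym r′))
        }
        where
        nat : ∀ t h → S.Moved.exchange N t (f h) ≡ f (S.Moved.exchange M t h)
        nat t h with t Fin.≟ t₀
        ... | no _  = refl
        ... | yes _ = trans (cong₂ (λ x y → PC.transpose x y (f h))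
                          (sym (preserves-from t₀ _)) (sym (preserves-from t₀ _)))
                        (transpose-natural f f-injective _ _ h)
      go (S.kept _ ¬o _) (S.swapped _ o _) = contradiction (Obstructed-map (≈ₘ-sym iso) o) ¬o
      go (S.swapped _ o _) (S.kept _ ¬o _) = contradiction (Obstructed-map iso o) ¬o

    -- The reverse move starts its test at the mark of the block `b q`. In the kept case this is
    -- `x`, whose walk avoids `s` by `¬Visits′`. In the swapped case it is now `y`, whose walk meets
    -- `s` by `Visits′`, and the reverse move transposes the same pair again.
    Stepped-sym : ∀ {M : Model k n b} {M′ : Model k n b′} → S.Stepped M M′ → S′.Stepped M′ M
    Stepped-sym {M} {M′} (S.kept r ¬obs e) = S′.kept (sym r) obs′ (λ t h → sym (e t h))
      where
      open S.Moved M
      open S.Arranged M (Model.position M′)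
      open Kept e ¬obs
      from-eq : ∀ z → from (Model.position M′ t₀) z ≡ from (position t₀) z
      from-eq z = from-cong-on (Model.position M′ t₀) (position t₀) id (λ h → sym (e t₀ h)) z
      obs′ : ¬ S′.Moved.Obstructed M′
      obs′ vs = ¬Visits′ (subst₂ (λ r z → Visits parent′ r Moving z) (cong (type-k ,_) r) (cong (t₀ ,_) (from-eq _))
        (Visits-≐ (λ _ → refl) (λ mov → trans mov (cong (t₀ ,_) (from-eq _))) vs))
    Stepped-sym {M} {M′} (S.swapped r obs e) = S′.swapped (sym r) obs′ pos-eq
      where
      open S.Moved M
      open S.Arranged M (Model.position M′)
      open Swap e obs
      obs′ : S′.Moved.Obstructed M′
      obs′ = subst₂ (λ r z → Visits parent′ r (S′.Moved.Moving M′) z)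
        (cong (type-k ,_) (sym r)) (cong (t₀ ,_) (sym from-y))
        (Visits-≐ (λ _ → refl) (λ mov → trans mov (cong (t₀ ,_) (sym from-s))) Visits′)
      exchange-eq : ∀ t h → S′.Moved.exchange M′ t h ≡ exchange t h
      exchange-eq t h with t Fin.≟ t₀
      ... | no _  = refl
      ... | yes _ = cong₂ (λ x y → PC.transpose x y h) from-x from-y
      pos-eq : ∀ t h → to (position t) h ≡ to (Model.position M′ t) (S′.Moved.exchange M′ t h)
      pos-eq t h = sym (trans (e t _) (cong (to (position t))
        (trans (cong (exchange t) (exchange-eq t h)) (exchange-involutive t h))))

  step-bijection : ∀ {b b′ : ∀ t → Fin (m t) → Fin (p t)} {t₀ q} →
                   (∀ {t} z → (t , z) ≢ (t₀ , q) → b t z ≡ b′ t z) → Bijection (ℳ b) (ℳ b′)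
  step-bijection {b} {b′} {t₀} {q} agree = correspondence⇒Bijection (ℳ b) (ℳ b′) S.Stepped S.total
    (λ M′ → let M , st = S′.total M′ in M , Stepped-sym agree′ agree st)
    (Stepped-cong agree agree′)
    (λ s s′ → Stepped-cong agree′ agree (Stepped-sym agree agree′ s) (Stepped-sym agree agree′ s′))
    where
    agree′ : ∀ {t} z → (t , z) ≢ (t₀ , q) → b′ t z ≡ b t z
    agree′ z ≢q = sym (agree z ≢q)
    module S  = Step b b′ t₀ q agree
    module S′ = Step b′ b t₀ q agree′

-- Passing between arbitrary block maps by successive moves.

module _ {k n : ℕ} .{{_ : NonTrivial k}} {p m : Fin k → ℕ} where

  private
    Slot = Σ (Fin k) (Fin ∘ m)

    _≟ₛ_ : DecidableEquality Slot
    _≟ₛ_ = ≡-dec Fin._≟_ Fin._≟_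

  retag : ∀ {b b′ : ∀ t → Fin (m t) → Fin (p t)} → (∀ t z → b t z ≡ b′ t z) →
          (M : Model k n b) → ∃ λ (N : Model k n b′) → M ≈ₘ N
  retag b≗b′ M = record
      { position    = position
      ; root        = root
      ; root-marked = trans (sym (mark≗ type-k root)) root-marked
      ; reach       = λ v → Reach-map id id refl (λ (t , h) → cong (next t ,_) (mark≗ (next t) h)) (reach v)
      }
    , record { σ = Perm.id ; preserves-position = λ _ _ → refl ; preserves-root = refl }
    where
    open Model M
    mark≗ : ∀ t h → mark t h ≡ marker _ (position t) h
    mark≗ t = marker-natural (position t) (position t) id (b≗b′ t) (λ _ → refl)

  retag-bijection : ∀ {b b′ : ∀ t → Fin (m t) → Fin (p t)} → (∀ t z → b t z ≡ b′ t z) → Bijection (ℳ b) (ℳ b′)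
  retag-bijection {b} {b′} b≗b′ = correspondence⇒Bijection (ℳ b) (ℳ b′) _≈ₘ_ (retag b≗b′)
    (λ N → let M , N≈M = retag (λ t z → sym (b≗b′ t z)) N in M , ≈ₘ-sym N≈M)
    (λ r r′ e → ≈ₘ-trans (≈ₘ-sym r) (≈ₘ-trans e r′))
    (λ r r′ e → ≈ₘ-trans r (≈ₘ-trans e (≈ₘ-sym r′)))

  -- Induction on the slots that may still differ: the intermediate map `b″` is `b′` at the head
  -- slot and `b` elsewhere.
  moves-bijection : ∀ (moves : List Slot) {b b′ : ∀ t → Fin (m t) → Fin (p t)} →
                    (∀ t z → (t , z) ∉ moves → b t z ≡ b′ t z) → Bijection (ℳ {n = n} b) (ℳ {n = n} b′)
  moves-bijection [] agree = retag-bijection λ t z → agree t z λ ()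
  moves-bijection (s ∷ moves) {b} {b′} agree =
    bijection (step-bijection {b′ = b″} λ z ≢s → sym (b″-off z ≢s)) (moves-bijection moves b″-agree)
    where
    b″ : ∀ t → Fin (m t) → Fin (p t)
    b″ t z with (t , z) ≟ₛ s
    ... | yes _ = b′ t z
    ... | no _  = b t z
    b″-off : ∀ {t} z → (t , z) ≢ s → b″ t z ≡ b t z
    b″-off {t} z ≢s with (t , z) ≟ₛ s
    ... | yes ≡s = contradiction ≡s ≢s
    ... | no _   = refl
    b″-agree : ∀ t z → (t , z) ∉ moves → b″ t z ≡ b′ t z
    b″-agree t z ∉moves with (t , z) ≟ₛ s
    ... | yes _ = refl
    ... | no ≢s = agree t z λ where
      (here ≡s)    → ≢s ≡s
      (there ∈moves) → ∉moves ∈moves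

  model-bijection : (b b′ : ∀ t → Fin (m t) → Fin (p t)) → Bijection (ℳ {n = n} b) (ℳ {n = n} b′)
  -- With every slot on the list, the agreement required off the list is vacuous.
  model-bijection b b′ = moves-bijection (concatMap (λ t → map (t ,_) (allFin (m t))) (allFin k))
    λ t z ∉all → contradiction (∈-concatMap⁺ (λ t → map (t ,_) (allFin (m t)))
      (lose (∈-allFin t) (∈-map⁺ (t ,_) (∈-allFin z)))) ∉all

-- Blocks as cycles

record Enumeration {X I : Set} (lab : X → I) (size : I → ℕ) : Set where
  field
    seq       : I → ℕ → X
    index     : X → ℕ
    lab-seq   : ∀ i x → lab (seq i x) ≡ i
    seq-index : ∀ x → seq (lab x) (index x) ≡ x
    period    : ∀ i → HasPeriod (seq i) (size i)

  index-seq : ∀ i x → seq i (index (seq i x)) ≡ seq i x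
  index-seq i x = trans (cong (λ j → seq j (index (seq i x))) (sym (lab-seq i x))) (seq-index (seq i x))

module _ {X Y I : Set} {lab : X → I} {lab′ : Y → I} {size : I → ℕ}
         (E : Enumeration lab size) (E′ : Enumeration lab′ size) where
  private
    module E  = Enumeration E
    module E′ = Enumeration E′

  transfer : X → Y
  transfer x = E′.seq (lab x) (E.index x)

  -- Any time at which `x` is listed gives the same image, because both listings of the fibre over
  -- `i` have the same period.
  transfer-seq : ∀ i x → transfer (E.seq i x) ≡ E′.seq i x
  transfer-seq i x = trans (cong (λ j → E′.seq j (E.index (E.seq i x))) (E.lab-seq i x))
    (same-period (E.period i) (E′.seq i) (HasPeriod.periodic (E′.period i)) _ _ (E.index-seq i x))

enumerations⇒↔ : ∀ {X Y I : Set} {lab : X → I} {lab′ : Y → I} {size : I → ℕ} →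
                 Enumeration lab size → Enumeration lab′ size → X ↔ Y
enumerations⇒↔ E E′ = mk↔ₛ′ (transfer E E′) (transfer E′ E)
  (λ y → trans (transfer-seq E E′ _ _) (Enumeration.seq-index E′ y))
  (λ x → trans (transfer-seq E′ E _ _) (Enumeration.seq-index E x))

rotate : ∀ {X I : Set} {lab : X → I} {size : I → ℕ} → Enumeration lab size → Enumeration lab size
rotate {lab = lab} {size} E = record
  { seq       = λ i x → seq i (suc x)
  -- The size minus one, together with the shift by one in `seq`, makes a full period.
  ; index     = λ x → index x + pred (size (lab x))
  ; lab-seq   = λ i x → lab-seq i (suc x)
  ; seq-index = λ x → trans (back (period (lab x)) (index x)) (seq-index x)
  ; period    = λ i → shift-HasPeriod (period i)
  }
  where
  open Enumeration E
  back : ∀ {X : Set} {f : ℕ → X} {c} → HasPeriod f c → ∀ y → f (suc (y + pred c)) ≡ f y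
  back {c = zero}          per y = contradiction (HasPeriod.0<period per) λ ()
  back {f = f} {c = suc c} per y = trans (cong f (sym (+-suc y c))) (HasPeriod.periodic per y)

-- Counting the elements of a cycle.

count-toList : ∀ {A : Set} {Q : A → Set} (Q? : Decidable Q) {n} (xs : Vec.Vec A n) →
               Vec.count Q? xs ≡ length (filter Q? (Vec.toList xs))
count-toList Q? Vec.[] = refl
count-toList Q? (x Vec.∷ xs) with does (Q? x)
... | true  = cong suc (count-toList Q? xs)
... | false = count-toList Q? xs

toList-allFin : ∀ n → Vec.toList (Vec.allFin n) ≡ allFin n
toList-allFin n = go n id
  where
  go : ∀ {A : Set} n (f : Fin n → A) → Vec.toList (Vec.tabulate f) ≡ tabulate f
  go zero    f = refl
  go (suc n) f = cong (f Fin.zero ∷_) (go n (f ∘ Fin.suc))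

-- The filtered list and one period of `f` are both duplicate-free and have the same elements, hence
-- the same length. This identifies hyperdegrees with cycle lengths.
count-period : ∀ {n c} {Q : Fin n → Set} (Q? : Decidable Q) {f : ℕ → Fin n} → HasPeriod f c →
               (∀ x → Q (f x)) → (∀ {h} → Q h → ∃ λ x → f x ≡ h) →
               Vec.count Q? (Vec.allFin n) ≡ c
count-period {c = zero} Q? per sound complete = contradiction (HasPeriod.0<period per) λ ()
count-period {n} {suc c} {Q} Q? {f} per sound complete = begin
  Vec.count Q? (Vec.allFin n)                     ≡⟨ count-toList Q? (Vec.allFin n) ⟩
  length (filter Q? (Vec.toList (Vec.allFin n)))  ≡⟨ cong (length ∘ filter Q?) (toList-allFin n) ⟩
  length (filter Q? (allFin n))                   ≡⟨ ↭-length (∼bag⇒↭ (unique∧set⇒bag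
                                                       (Unique.filter⁺ Q? (Unique.allFin⁺ n)) cycle-unique
                                                       (mk⇔ forth back))) ⟩
  length (applyUpTo f (suc c))                    ≡⟨ length-applyUpTo f (suc c) ⟩
  suc c                                           ∎
  where
  open ≡-Reasoning
  cycle-unique : Unique (applyUpTo f (suc c))
  cycle-unique = Unique.applyUpTo⁺₁ f (suc c) λ i<j j<c eq →
    <⇒≢ i<j (HasPeriod.injective per (<-trans i<j j<c) j<c eq)
  forth : ∀ {h} → h ∈ filter Q? (allFin n) → h ∈ applyUpTo f (suc c)
  forth h∈ with complete (proj₂ (∈-filter⁻ Q? {xs = allFin n} h∈))
  ... | x , refl = subst (_∈ applyUpTo f (suc c)) (sym (reduce (HasPeriod.periodic per) x))
                     (∈-applyUpTo⁺ f (m%n<n x (suc c)))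
  back : ∀ {h} → h ∈ applyUpTo f (suc c) → h ∈ filter Q? (allFin n)
  back h∈ with ∈-applyUpTo⁻ f h∈
  ... | x , _ , refl = ∈-filter⁺ Q? (∈-allFin (f x)) (sound x)

-- seq i lists the positions of block i cyclically, starting at its mark. The bijection relabel only transports
-- the labels Fin (ℓ γ) along an equation ℓ γ ≡ p.
record Layout {n : ℕ} (γ : Composition n) (p m : ℕ) : Set where
  field
    relabel     : Fin (ℓ γ) ↔ Fin p
    blocks      : Fin m → Fin p
    enumeration : Enumeration (block blocks) (part γ ∘ from relabel)

  open Enumeration enumeration public

  field
    seq-0 : ∀ i → seq i 0 ≡ inj₁ i

-- Layouts built from compositions.

module _ {p m : ℕ} {d : Fin p → ℕ} (split : Fin m ↔ Σ (Fin p) (Fin ∘ d)) where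

  splitBlocks : Fin m → Fin p
  splitBlocks = proj₁ ∘ to split

  private
    -- Time 0 is the mark and the later times are the `d i` unmarked positions, whence the size
    -- `suc (d i)`. The bound is irrelevant, so equal times suffice for equal positions.
    at : ∀ i x → .(x < suc (d i)) → Fin p ⊎ Fin m
    at i zero    _  = inj₁ i
    at i (suc x) lt = inj₂ (from split (i , fromℕ< (s<s⁻¹ lt)))

    index : Fin p ⊎ Fin m → ℕ
    index (inj₁ _) = 0
    index (inj₂ z) = suc (toℕ (proj₂ (to split z)))

    at-cong : ∀ i {x y} .(x< : x < suc (d i)) .(y< : y < suc (d i)) → x ≡ y → at i x x< ≡ at i y y<
    at-cong i _ _ refl = refl

    block-at : ∀ i x .(lt : x < suc (d i)) → block splitBlocks (at i x lt) ≡ i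
    block-at i zero    _  = refl
    block-at i (suc x) lt = cong proj₁ (strictlyInverseˡ split _)

    index-at : ∀ i x .(lt : x < suc (d i)) → index (at i x lt) ≡ x
    index-at i zero    _  = refl
    index-at i (suc x) lt = cong suc (trans
      (cong (λ (iy : Σ (Fin p) (Fin ∘ d)) → toℕ (proj₂ iy)) (strictlyInverseˡ split (i , fromℕ< (s<s⁻¹ lt))))
      (Fin.toℕ-fromℕ< (s<s⁻¹ lt)))

    index< : ∀ z → index z < suc (d (block splitBlocks z))
    index< (inj₁ _) = z<s
    index< (inj₂ z) = s<s (Fin.toℕ<n (proj₂ (to split z)))

    at-index : ∀ z .(lt : index z < suc (d (block splitBlocks z))) → at (block splitBlocks z) (index z) lt ≡ z
    at-index (inj₁ _) _  = refl
    at-index (inj₂ z) lt = cong inj₂ (trans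
      (cong (λ y → from split (proj₁ (to split z) , y)) (Fin.fromℕ<-toℕ (proj₂ (to split z)) _))
      (strictlyInverseʳ split z))

  splitEnumeration : Enumeration (block splitBlocks) (suc ∘ d)
  splitEnumeration = record
    { seq       = λ i x → at i (x % suc (d i)) (m%n<n x (suc (d i)))
    ; index     = index
    ; lab-seq   = λ i x → block-at i (x % suc (d i)) _
    ; seq-index = λ z → trans (at-cong _ _ (index< z) (m<n⇒m%n≡m (index< z))) (at-index z (index< z))
    ; period    = λ i → record
      { 0<period  = z<s
      ; periodic  = λ x → at-cong i _ _ ([m+n]%n≡m%n x (suc (d i)))
      ; injective = λ {x} {y} x< y< eq → begin
          x                                   ≡⟨ m<n⇒m%n≡m x< ⟨
          x % suc (d i)                       ≡⟨ index-at i _ (m%n<n x (suc (d i))) ⟨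
          index (at i (x % suc (d i)) _)      ≡⟨ cong index eq ⟩
          index (at i (y % suc (d i)) _)      ≡⟨ index-at i _ (m%n<n y (suc (d i))) ⟩
          y % suc (d i)                       ≡⟨ m<n⇒m%n≡m y< ⟩
          y                                   ∎
      }
    }
    where open ≡-Reasoning

  splitEnumeration-0 : ∀ i → Enumeration.seq splitEnumeration i 0 ≡ inj₁ i
  splitEnumeration-0 i = refl

resize : ∀ {X I : Set} {lab : X → I} {size size′ : I → ℕ} → (∀ i → size i ≡ size′ i) →
         Enumeration lab size → Enumeration lab size′
resize eq E = record
  { seq       = seq
  ; index     = index
  ; lab-seq   = lab-seq
  ; seq-index = seq-index
  ; period    = λ i → subst (HasPeriod (seq i)) (eq i) (period i)
  }
  where open Enumeration E

-- One position of each block, the marked one, is set apart: hence pred.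
splitting : ∀ xs → Fin (sum (map pred xs)) ↔ Σ (Fin (length xs)) (Fin ∘ pred ∘ lookup xs)
splitting []       = mk↔ₛ′ (λ ()) (λ ()) (λ ()) (λ ())
splitting (x ∷ xs) = cons ↔-∘ ((↔-id _ ⊎-↔ splitting xs) ↔-∘ Fin.+↔⊎)
  where
  cons : (Fin (pred x) ⊎ Σ (Fin (length xs)) (Fin ∘ pred ∘ lookup xs)) ↔
         Σ (Fin (suc (length xs))) (Fin ∘ pred ∘ lookup (x ∷ xs))
  cons = mk↔ₛ′ (λ { (inj₁ y) → Fin.zero , y ; (inj₂ (i , y)) → Fin.suc i , y })
               (λ { (Fin.zero , y) → inj₁ y ; (Fin.suc i , y) → inj₂ (i , y) })
               (λ { (Fin.zero , y) → refl ; (Fin.suc i , y) → refl })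
               (λ { (inj₁ y) → refl ; (inj₂ (i , y)) → refl })

length+sum-pred : ∀ {xs} → All (0 <_) xs → length xs + sum (map pred xs) ≡ sum xs
length+sum-pred []                        = refl
length+sum-pred {suc x ∷ xs} (z<s ∷ 0<xs) = cong suc (begin
  length xs + (x + sum (map pred xs))   ≡⟨ +-assoc (length xs) x _ ⟨
  length xs + x + sum (map pred xs)     ≡⟨ cong (_+ sum (map pred xs)) (+-comm (length xs) x) ⟩
  x + length xs + sum (map pred xs)     ≡⟨ +-assoc x (length xs) _ ⟩
  x + (length xs + sum (map pred xs))   ≡⟨ cong (x +_) (length+sum-pred 0<xs) ⟩
  x + sum xs                            ∎)
  where open ≡-Reasoning

-- Passing the length as `p` with an equation gives `γ` and `δ` literally the same numbers of marked
-- and unmarked positions, so their models differ only in the block map.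
layout : ∀ {n} (γ : Composition n) {p} → ℓ γ ≡ p → Layout γ p (n ∸ p)
layout {n} γ refl = record
  { relabel     = ↔-id _
  ; blocks      = splitBlocks split
  ; enumeration = resize (λ i → suc-pred (part γ i) {{>-nonZero (All.lookup positive (∈-lookup i))}})
                         (splitEnumeration split)
  ; seq-0       = splitEnumeration-0 split
  }
  where
  open Composition γ
  split : Fin (n ∸ ℓ γ) ↔ Σ (Fin (ℓ γ)) (Fin ∘ pred ∘ part γ)
  split = subst (λ m → Fin m ↔ Σ (Fin (ℓ γ)) (Fin ∘ pred ∘ part γ))
    (trans (sym (m+n∸m≡n (ℓ γ) _)) (cong (_∸ ℓ γ) (trans (length+sum-pred positive) sum-parts)))
    (splitting parts)

-- Orbits and cycles of permutations.

module _ {n : ℕ} {I : Set} {π : I → Permutation′ n} where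

  Generated-invariant : ∀ {X : Set} (f : Fin n → X) → (∀ i h → f (π i ⟨$⟩ʳ h) ≡ f h) →
                        ∀ {ρ} → Generated π ρ → ∀ h → f (ρ ⟨$⟩ʳ h) ≡ f h
  Generated-invariant f inv (generator i) h = inv i h
  Generated-invariant f inv identity h = refl
  Generated-invariant f inv (compose g g′) h =
    trans (Generated-invariant f inv g′ _) (Generated-invariant f inv g h)
  Generated-invariant f inv (inverse {ρ} g) h =
    trans (sym (Generated-invariant f inv g _)) (cong f (Perm.inverseʳ ρ))

  SameOrbit-invariant : ∀ {X : Set} (f : Fin n → X) → (∀ i h → f (π i ⟨$⟩ʳ h) ≡ f h) →
                        ∀ {h h′} → SameOrbit π h h′ → f h ≡ f h′
  SameOrbit-invariant f inv (ρ , g , refl) = sym (Generated-invariant f inv g _)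

  SameCycle⇒SameOrbit : ∀ {i h h′} → SameCycle (π i) h h′ → SameOrbit π h h′
  SameCycle⇒SameOrbit {i} (ρ , g , eq) = ρ , include g , eq
    where
    include : ∀ {ρ} → Generated (const (π i)) ρ → Generated π ρ
    include (generator _)  = generator i
    include identity       = identity
    include (compose g g′) = compose (include g) (include g′)
    include (inverse g)    = inverse (include g)

module _ {n : ℕ} (π : Permutation′ n) where

  power : Fin n → ℕ → Fin n
  power h = fold h (π ⟨$⟩ʳ_)

  power-SameCycle : ∀ h x → SameCycle π h (power h x)
  power-SameCycle h zero    = Perm.id , identity , refl
  power-SameCycle h (suc x) with ρ , g , eq ← power-SameCycle h x =
    ρ ∘ₚ π , compose g (generator _) , cong (π ⟨$⟩ʳ_) eq

  power-injective : ∀ x {h h′} → power h x ≡ power h′ x → h ≡ h′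
  power-injective zero    eq = eq
  power-injective (suc x) eq = power-injective x (to-injective π eq)

  -- Orbits are eventually periodic, and injectivity of the permutation cancels the part before the
  -- period.
  power-return : ∀ h → ∃ λ d → power h (suc d) ≡ h
  power-return h with x , d , eq ← eventually-periodic (π ⟨$⟩ʳ_) Fin._≟_ (↔⇒↣ Perm.id) h =
    d , power-injective x (begin
      power (power h (suc d)) x  ≡⟨ fold-+ h (π ⟨$⟩ʳ_) x ⟨
      power h (x + suc d)        ≡⟨ cong (power h) (+-comm x (suc d)) ⟩
      power h (suc d + x)        ≡⟨ fold-+ h (π ⟨$⟩ʳ_) (suc d) ⟩
      power (power h x) (suc d)  ≡⟨ eq ⟩
      power h x                  ∎)
    where open ≡-Reasoning

  power-period : ∀ h → ∃ (HasPeriod (power h))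
  power-period h with d , eq ← power-return h = orbit-period (π ⟨$⟩ʳ_) Fin._≟_ h d eq

  preimage-power : ∀ h → ∃ λ x → power h x ≡ π Perm.⟨$⟩ˡ h
  preimage-power h with d , eq ← power-return h =
    d , to-injective π (trans eq (sym (Perm.inverseʳ π)))

  -- Cycles are finite, so the inverse of `π` acts at each point as a nonnegative power
  -- (`preimage-power`), and forward iteration exhausts the cycle.
  SameCycle⇒power : ∀ {h h′} → SameCycle π h h′ → ∃ λ x → power h x ≡ h′
  SameCycle⇒power (ρ , g , refl) = go g _
    where
    chain : ∀ {h h′ h″} → (∃ λ x → power h x ≡ h′) → (∃ λ x → power h′ x ≡ h″) → ∃ λ x → power h x ≡ h″
    chain {h} (x , refl) (y , refl) = y + x , fold-+ h (π ⟨$⟩ʳ_) y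
    back : ∀ x h → ∃ λ y → power (power h x) y ≡ h
    back zero    h = 0 , refl
    back (suc x) h = chain
      (let y , eq = preimage-power (power h (suc x)) in y , trans eq (Perm.inverseˡ π))
      (back x h)
    go : ∀ {ρ} → Generated (const π) ρ → ∀ h → ∃ λ x → power h x ≡ ρ ⟨$⟩ʳ h
    go (generator _)  h = 1 , refl
    go identity       h = 0 , refl
    go (compose g g′) h = chain (go g h) (go g′ _)
    go (inverse {ρ} g) h with x , eq ← go g (ρ Perm.⟨$⟩ˡ h) =
      let y , eq′ = back x (ρ Perm.⟨$⟩ˡ h)
      in y , trans (cong (λ u → power u y) (sym (trans eq (Perm.inverseʳ ρ)))) eq′

-- As `k` is at least 2, an edge of type `t` can meet a vertex of type `t` only at its source.
next≢ : ∀ {k} .{{_ : NonTrivial k}} (t : Fin k) → next t ≢ t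
next≢ {1} t = λ _ → contradiction refl (nonTrivial⇒≢1 {1})
next≢ {suc (suc k)} t eq with m≤n⇒m<n∨m≡n (Fin.toℕ<n t)
... | inj₁ 1+t<k = 1+n≢n (trans (sym (m<n⇒m%n≡m 1+t<k)) toℕ-eq)
  where
  toℕ-eq : suc (toℕ t) % suc (suc k) ≡ toℕ t
  toℕ-eq = trans (sym (Fin.toℕ-fromℕ< (m%n<n (suc (toℕ t)) (suc (suc k))))) (cong toℕ eq)
... | inj₂ 1+t≡k = contradiction (trans (sym (suc-injective 1+t≡k)) toℕ-eq) λ ()
  where
  toℕ-eq : toℕ t ≡ 0
  toℕ-eq = begin
    toℕ t                                ≡⟨ cong toℕ eq ⟨
    toℕ (next t)                         ≡⟨ Fin.toℕ-fromℕ< (m%n<n (suc (toℕ t)) (suc (suc k))) ⟩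
    suc (toℕ t) % suc (suc k)            ≡⟨ cong (_% suc (suc k)) 1+t≡k ⟩
    suc (suc k) % suc (suc k)            ≡⟨ n%n≡0 (suc (suc k)) ⟩
    0                                    ∎
    where open ≡-Reasoning

-- Arborescences and marks

module Walks (G : Multigraph) (A : Pred (Multigraph.Edge G) 0ℓ) where
  open Multigraph G
  open Setoid vertices using () renaming (refl to ≈-refl; sym to ≈-sym; trans to ≈-trans)

  walk-resp : ∀ {u v w} → u ≈ᵥ v → Walk A v w → Walk A u w
  walk-resp u≈v (stop v≈w)                    = stop (≈-trans u≈v v≈w)
  walk-resp u≈v (step e a (inj₁ (s , t)) w)   = step e a (inj₁ (≈-trans s (≈-sym u≈v) , t)) w
  walk-resp u≈v (step e a (inj₂ (s , t)) w)   = step e a (inj₂ (s , ≈-trans t (≈-sym u≈v))) w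

  walk-trans : ∀ {u v w} → Walk A u v → Walk A v w → Walk A u w
  walk-trans (stop u≈v)     w′ = walk-resp u≈v w′
  walk-trans (step e a J w) w′ = step e a J (walk-trans w w′)

  walk-sym : ∀ {u v} → Walk A u v → Walk A v u
  walk-sym (stop u≈v)     = stop (≈-sym u≈v)
  walk-sym (step e a J w) = walk-trans (walk-sym w) (step e a ([ inj₂ , inj₁ ]′ J) (stop ≈-refl))

-- A mark selects one hyperedge in each cycle, so vertices become fixed points of `markₑ`, and `≈⇒≡`
-- turns equality of vertices into equality of marks. A fixed point `v` also names an edge, the one
-- from the vertex `v` to the vertex `parent v`.
module Marked {k n : ℕ} .{{_ : NonTrivial k}} (C : Constellation k n) (mark : Fin k → Fin n → Fin n)
              (sound : ∀ t {h h′} → SameCycle (Constellation.π C t) h h′ → mark t h ≡ mark t h′)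
              (complete : ∀ t h → SameCycle (Constellation.π C t) h (mark t h)) where

  open Constellation C
  open Multigraph underlyingGraph
  open Setoid allVertices using () renaming (refl to ≈-refl; sym to ≈-sym; trans to ≈-trans)

  markₑ : Fin k × Fin n → Fin k × Fin n
  markₑ (t , h) = t , mark t h

  parent : Fin k × Fin n → Fin k × Fin n
  parent v = markₑ (advance v)

  ≈-markₑ : ∀ v → v ≈ᵥ markₑ v
  ≈-markₑ (t , h) = refl , complete t h

  ≈⇒≡ : ∀ {u v} → u ≈ᵥ v → markₑ u ≡ markₑ v
  ≈⇒≡ {t , _} (refl , c) = cong (t ,_) (sound t c)

  markₑ-idem : ∀ v → markₑ (markₑ v) ≡ markₑ v
  markₑ-idem v = sym (≈⇒≡ (≈-markₑ v))

  joins-parent : ∀ v → Joins v v (parent v)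
  joins-parent v = inj₁ (≈-refl , ≈-markₑ (advance v))

  module _ (A : Pred (Fin k × Fin n) 0ℓ) where
    open Walks underlyingGraph A

    -- The walk leaves each vertex `f y` along the edge of the same name. Its edge list is therefore
    -- explicit, and distinctness of the points `f y` yields `Unique`.
    climb : (f : ℕ → Fin k × Fin n) → (∀ y → f (suc y) ≡ parent (f y)) →
            ∀ c → (∀ {y} → y < c → A (f y)) →
            Σ (Walk A (f 0) (f c)) λ w → edges A w ≡ applyUpTo f c
    climb f f-suc zero    _   = stop ≈-refl , refl
    climb f f-suc (suc c) all = 
      let w , eq = climb (f ∘ suc) (f-suc ∘ suc) c (λ y<c → all (s<s y<c))
      in step (f 0) (all z<s) (subst (Joins (f 0) (f 0)) (sym (f-suc 0)) (joins-parent (f 0))) w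
       , cong (f 0 ∷_) eq

    module FromReach {r : Fin k × Fin n} (reach : ∀ v → Reach parent r v)
                     (A⇔ : ∀ v → A v ⇔ (markₑ v ≡ v × v ≢ r)) where

      walk-to-root : ∀ v → Walk A v r
      walk-to-root v = walk-resp (≈-markₑ v) (go (reach (markₑ v)) (markₑ-idem v))
        where
        go : ∀ {v} → Reach parent r v → markₑ v ≡ v → Walk A v r
        go (Reach.here refl)      _      = stop ≈-refl
        go {v} (Reach.step v≢r ρ) marked =
          step v (Equivalence.from (A⇔ v) (marked , v≢r)) (joins-parent v) (go ρ (markₑ-idem (advance v)))

      connected : Connected A
      connected u v = walk-trans (walk-to-root u) (walk-sym (walk-to-root v))

      joins⇒ : ∀ {e u v} → A e → Joins e u v →
               (e ≡ markₑ u × parent e ≡ markₑ v) ⊎ (e ≡ markₑ v × parent e ≡ markₑ u)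
      joins⇒ {e} a J with proj₁ (Equivalence.to (A⇔ e) a)
      joins⇒ {e} a (inj₁ (s , t)) | marked = inj₁ (trans (sym marked) (≈⇒≡ s) , ≈⇒≡ t)
      joins⇒ {e} a (inj₂ (s , t)) | marked = inj₂ (trans (sym marked) (≈⇒≡ s) , ≈⇒≡ t)

      nonroot : ∀ {e} → A e → e ≢ r
      nonroot a = proj₂ (Equivalence.to (A⇔ _) a)

      Below : Fin k × Fin n → Fin k × Fin n → Set
      Below z u = Desc parent r z (markₑ u)

      -- A point and its parent lie on different sides of the subtree of `z` only when the point is
      -- `z`. So a walk that crosses the boundary, here outwards and in `entering` inwards,
      -- traverses the edge `z`.
      leaving : ∀ {z u v} (w : Walk A u v) → Below z u → ¬ Below z v → z ∈ edges A w
      leaving {z} (stop u≈v) δ ¬δ = contradiction (subst (Desc parent r z) (≈⇒≡ u≈v) δ) ¬δ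
      leaving {z} (step e a J w) δ ¬δ with joins⇒ a J
      ... | inj₂ (e≡ , p≡) = there (leaving w
        (subst (Desc parent r z) e≡ (up (nonroot a) (subst (Desc parent r z) (sym p≡) δ))) ¬δ)
      ... | inj₁ (refl , p≡) with δ
      ...   | Desc.here e≡z = here (sym e≡z)
      ...   | up _ δ′       = there (leaving w (subst (Desc parent r z) p≡ δ′) ¬δ)

      entering : ∀ {z u v} (w : Walk A u v) → ¬ Below z u → Below z v → z ∈ edges A w
      entering {z} (stop u≈v) ¬δ δ = contradiction (subst (Desc parent r z) (sym (≈⇒≡ u≈v)) δ) ¬δ
      entering {z} (step e a J w) ¬δ δ with joins⇒ a J
      ... | inj₁ (e≡ , p≡) = there (entering w (λ δ′ → ¬δ
        (subst (Desc parent r z) e≡ (up (nonroot a) (subst (Desc parent r z) (sym p≡) δ′)))) δ)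
      ... | inj₂ (e≡ , p≡) with z ≟ₑ e
      ...   | yes z≡e = here z≡e
      ...   | no z≢e  = there (entering w (λ δ′ → ¬δ (subst (Desc parent r z) p≡
                (above (subst (Desc parent r z) (sym e≡) δ′)))) δ)
        where
        above : Desc parent r z e → Desc parent r z (parent e)
        above (Desc.here e≡z) = contradiction (sym e≡z) z≢e
        above (up _ δ)        = δ

      -- After its first edge e, a closed walk joins the two sides of e in the tree, so it traverses e again.
      acyclic : Acyclic A
      acyclic (stop _) _ = refl
      acyclic (step e a J w) (e∉ ∷ _) = contradiction refl (All.lookup e∉ e∈)
        where
        e∈ : e ∈ edges A w
        e∈ with joins⇒ a J
        ... | inj₁ (e≡ , p≡) = entering w
          (parent-not-Desc (nonroot a) (reach e) ∘ subst (Desc parent r e) (sym p≡)) (Desc.here (sym e≡))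
        ... | inj₂ (e≡ , p≡) = leaving w (Desc.here (sym e≡))
          (parent-not-Desc (nonroot a) (reach e) ∘ subst (Desc parent r e) (sym p≡))

      uniqueEdge : ∀ t h → ¬ (t , h) ≈ᵥ r →
                   ∃ λ h′ → (A (t , h′) × Incident (t , h′) (t , h)) ×
                            (∀ {h″} → A (t , h″) × Incident (t , h″) (t , h) → h′ ≡ h″)
      uniqueEdge t h ¬root = mark t h
        , (Equivalence.from (A⇔ _) (markₑ-idem (t , h) , λ eq → ¬root (subst ((t , h) ≈ᵥ_) eq (≈-markₑ (t , h))))
          , inj₁ (≈-sym (≈-markₑ (t , h))))
        , λ where
          (a , inj₁ s≈)    → cong proj₂ (trans (sym (≈⇒≡ s≈)) (proj₁ (Equivalence.to (A⇔ _) a)))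
          (a , inj₂ (t≡ , _)) → contradiction t≡ (next≢ t)

    -- In an acyclic graph a parent-orbit outside the root cannot be periodic, and an
    -- edge leaving the root would close up with the path back to the root.
    module FromAcyclic (acyclic : Acyclic A) {r : Fin k × Fin n} (r-marked : markₑ r ≡ r)
                       (marked∈A : ∀ {v} → markₑ v ≡ v → v ≢ r → A v) where

      no-cycle : ∀ u c → HasPeriod (fold u parent) c → ¬ (∀ {y} → y < c → fold u parent y ≢ r)
      no-cycle u zero    per _  = contradiction (HasPeriod.0<period per) λ ()
      no-cycle u (suc c) per ≢r = close (f (suc c)) (HasPeriod.periodic per 0)
          (climb f (λ _ → refl) (suc c) (λ {y} y<c → marked∈A (f-marked y) (≢r y<c)))
        where
        f : ℕ → Fin k × Fin n
        f = fold u parent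
        f-marked : ∀ y → markₑ (f y) ≡ f y
        -- Lying on the cycle, `u` is itself a value of `parent` and hence marked.
        f-marked zero    = trans (cong markₑ (sym (HasPeriod.periodic per 0)))
          (trans (markₑ-idem (advance (f c))) (HasPeriod.periodic per 0))
        f-marked (suc y) = markₑ-idem (advance (f y))
        close : ∀ v → v ≡ u → ¬ Σ (Walk A u v) λ w → edges A w ≡ applyUpTo f (suc c)
        close v refl (w , eq) = case trans (sym eq) (acyclic w (subst Unique (sym eq)
          (Unique.applyUpTo⁺₁ f (suc c) λ i<j j<c e →
            <⇒≢ i<j (HasPeriod.injective per (<-trans i<j j<c) j<c e)))) of λ ()

      reach : ∀ v → Reach parent r v
      reach v = [ id , (λ (x , c , per , ≢r) → ⊥-elim (no-cycle (fold v parent x) c per ≢r)) ]′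
        (Reach-or-cycle (↔⇒↣ (↔-sym Fin.*↔×)) v)

      -- The unique-edge condition of an arborescence speaks only of the other vertices. With this,
      -- the tree consists of exactly the marks other than the root.
      root∉A : ∀ {v} → v ≈ᵥ r → ¬ A v
      root∉A {v} v≈r a = close (hitting-time (reach (parent v)))
        where
        f : ℕ → Fin k × Fin n
        f = fold (parent v) parent
        f-marked : ∀ y → markₑ (f y) ≡ f y
        f-marked zero    = markₑ-idem (advance v)
        f-marked (suc y) = markₑ-idem (advance (f y))
        f≡ : ∀ y → f y ≡ fold v parent (suc y)
        f≡ = fold-shift parent v
        close : ¬ ∃ λ c → f c ≡ r × (∀ {y} → y < c → f y ≢ r)
        close (c , f≡r , ≢r) with w , eq ← climb f (λ _ → refl) c (λ {y} y<c → marked∈A (f-marked y) (≢r y<c)) =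
          case acyclic (step v a (inj₁ (subst (v ≈ᵥ_) (sym f≡r) v≈r , ≈-markₑ (advance v))) w)
                 (subst (λ es → Unique (v ∷ es)) (sym eq) (All.applyUpTo⁺₁ f c v≢f ∷ Unique.applyUpTo⁺₁ f c f≢f))
          of λ ()
          where
          v≢f : ∀ {y} → y < c → v ≢ f y
          -- `v` is in the cycle of the root but possibly different from `r`; a marked point in that
          -- cycle can only be `r`.
          v≢f {y} y<c v≡f = ≢r y<c (begin
            f y          ≡⟨ f-marked y ⟨
            markₑ (f y)  ≡⟨ cong markₑ v≡f ⟨
            markₑ v      ≡⟨ ≈⇒≡ v≈r ⟩
            markₑ r      ≡⟨ r-marked ⟩
            r            ∎)
            where open ≡-Reasoning
          first : ∀ {x} → 0 < x → x < suc c → fold v parent x ≢ r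
          first {suc x} _ x<c eq = ≢r (s<s⁻¹ x<c) (trans (f≡ x) eq)
          f≢f : ∀ {x y} → x < y → y < c → f x ≢ f y
          -- The path is the orbit of `v` from time 1 on, and among the positive times `r` is first
          -- met at its end.
          f≢f {x} {y} x<y y<c eq = distinct-before parent (trans (sym (f≡ c)) f≡r) first
            z<s (s<s x<y) (s≤s (<⇒≤ y<c)) (trans (sym (f≡ x)) (trans eq (f≡ y)))

-- Coding tree-rooted constellations by models.

pull-HasPeriod : ∀ {X Y : Set} {f : ℕ → X} {g : ℕ → Y} (e : X → Y) → (∀ {x y} → e x ≡ e y → x ≡ y) →
                 (∀ x → e (f x) ≡ g x) → ∀ {c} → HasPeriod g c → HasPeriod f c
pull-HasPeriod e inj eq per = record
  { 0<period  = HasPeriod.0<period per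
  ; periodic  = λ x → inj (trans (eq _) (trans (HasPeriod.periodic per x) (sym (eq x))))
  ; injective = λ x< y< fx≡fy → HasPeriod.injective per x< y< (trans (sym (eq _)) (trans (cong e fx≡fy) (eq _)))
  }

does≡true⇒ : ∀ {P : Set} (P? : Dec P) → does P? ≡ true → P
does≡true⇒ (yes p) _ = p

∈-comprehension : ∀ {n} {P : Fin n → Set} (P? : Decidable P) h → h ∈ₛ Vec.tabulate (does ∘ P?) ⇔ P h
∈-comprehension P? h = mk⇔
  (λ h∈ → does≡true⇒ (P? h) (trans (sym (Vec.lookup∘tabulate (does ∘ P?) h)) (Vec.[]=⇒lookup h∈)))
  (λ p → Vec.lookup⇒[]= h _ (trans (Vec.lookup∘tabulate (does ∘ P?) h) (dec-true (P? h) p)))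

module Coding {k n : ℕ} .{{_ : NonTrivial k}} {γ : Fin k → Composition n} {p m : Fin k → ℕ}
              (L : ∀ t → Layout (γ t) (p t) (m t)) where

  module L t = Layout (L t)

  b : ∀ t → Fin (m t) → Fin (p t)
  b = L.blocks

  -- The successor in the cyclic order of each block. Under the position maps it becomes the
  -- permutation `π t`.
  κ : ∀ t → (Fin (p t) ⊎ Fin (m t)) ↔ (Fin (p t) ⊎ Fin (m t))
  κ t = enumerations⇒↔ (L.enumeration t) (rotate (L.enumeration t))

  κ-seq : ∀ t i x → to (κ t) (L.seq t i x) ≡ L.seq t i (suc x)
  κ-seq t = transfer-seq (L.enumeration t) (rotate (L.enumeration t))

  module _ (t : Fin k) (π : Permutation′ n) (w : Fin n ↔ (Fin (p t) ⊎ Fin (m t)))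
           (π-code : ∀ h → to w (π ⟨$⟩ʳ h) ≡ to (κ t) (to w h)) where

    power-code : ∀ i x → to w (power π (from w (inj₁ i)) x) ≡ L.seq t i x
    power-code i zero    = trans (strictlyInverseˡ w _) (sym (L.seq-0 t i))
    power-code i (suc x) = trans (π-code _) (trans (cong (to (κ t)) (power-code i x)) (κ-seq t i x))

    power-mark : ∀ h → power π (marker (b t) w h) (L.index t (to w h)) ≡ h
    power-mark h = to-injective w (trans (power-code _ _) (L.seq-index t (to w h)))

  record Codes (T : LabelledTreeRooted γ) (M : Model k n b) : Set where
    private
      module T = LabelledTreeRooted T
      module M = Model M
    field
      π-code     : ∀ t h → to (M.position t) (T.π t ⟨$⟩ʳ h) ≡ to (κ t) (to (M.position t) h)
      label-code : ∀ t h → to (L.relabel t) (T.label t h) ≡ block (b t) (to (M.position t) h)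
      root-code  : T.root ≡ M.root
      tree-code  : ∀ v → v ∈ₑ T.tree ⇔ (M.markₑ v ≡ v × v ≢ M.rootₑ)

  module _ {T T′ : LabelledTreeRooted γ} {M M′ : Model k n b} (c : Codes T M) (c′ : Codes T′ M′) where
    private
      module T  = LabelledTreeRooted T
      module T′ = LabelledTreeRooted T′
      module M  = Model M
      module M′ = Model M′
      module c  = Codes c
      module c′ = Codes c′

    -- A position is determined by its block and by the number of steps of `π` from the mark. Blocks
    -- are preserved because labels are, and marks because each is the root or an edge of the tree.
    Codes-cong : T ≅ T′ → M ≈ₘ M′
    Codes-cong iso = record
      { σ                  = σ
      ; preserves-position = preserves-position
      ; preserves-root     = trans (cong f (sym c.root-code)) (trans preserves-root c′.root-code)
      }
      where
      open _≅_ iso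
      f : Fin n → Fin n
      f = σ ⟨$⟩ʳ_
      block-eq : ∀ t h → block (b t) (to (M′.position t) (f h)) ≡ block (b t) (to (M.position t) h)
      block-eq t h = trans (sym (c′.label-code t (f h)))
        (trans (cong (to (L.relabel t)) (sym (preserves-label t h))) (c.label-code t h))
      marked-eq : ∀ t {h} → M.mark t h ≡ h → M′.mark t (f h) ≡ f h
      marked-eq t {h} marked with (t , h) ≟ₑ M.rootₑ
      -- The root is marked without belonging to the tree, so here the mark comes from
      -- `root-marked`.
      ... | yes refl = subst (λ u → M′.mark type-k u ≡ u)
              (sym (trans (cong f (sym c.root-code)) (trans preserves-root c′.root-code))) M′.root-marked
      ... | no  ≢r   = cong proj₂ (proj₁ (Equivalence.to (c′.tree-code (t , f h))
              (Equivalence.to (preserves-tree t h)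
                (Equivalence.from (c.tree-code (t , h)) (cong (t ,_) marked , ≢r)))))
      mark-eq : ∀ t h → f (M.mark t h) ≡ M′.mark t (f h)
      mark-eq t h = begin
        f (M.mark t h)                             ≡⟨ marked-eq t (marker-idem (M.position t) h) ⟨
        M′.mark t (f (M.mark t h))                 ≡⟨ cong (from (M′.position t) ∘ inj₁) (begin
          block (b t) (to (M′.position t) (f (M.mark t h)))  ≡⟨ block-eq t (M.mark t h) ⟩
          block (b t) (to (M.position t) (M.mark t h))       ≡⟨ cong (block (b t))
                                                                  (strictlyInverseˡ (M.position t) _) ⟩
          block (b t) (to (M.position t) h)                  ≡⟨ block-eq t h ⟨
          block (b t) (to (M′.position t) (f h))             ∎) ⟩
        M′.mark t (f h)                            ∎
        where open ≡-Reasoning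
      power-eq : ∀ t h x → f (power (T.π t) h x) ≡ power (T′.π t) (f h) x
      power-eq t h zero    = refl
      power-eq t h (suc x) = trans (preserves-π t _) (cong (T′.π t ⟨$⟩ʳ_) (power-eq t h x))
      preserves-position : ∀ t h → to (M′.position t) (f h) ≡ to (M.position t) h
      preserves-position t h = begin
        to (M′.position t) (f h)
          ≡⟨ cong (to (M′.position t) ∘ f) (power-mark t (T.π t) (M.position t) (c.π-code t) h) ⟨
        to (M′.position t) (f (power (T.π t) (M.mark t h) x))
          ≡⟨ cong (to (M′.position t)) (trans (power-eq t _ x) (cong (λ u → power (T′.π t) u x) (mark-eq t h))) ⟩
        to (M′.position t) (power (T′.π t) (M′.mark t (f h)) x)
          ≡⟨ power-code t (T′.π t) (M′.position t) (c′.π-code t) _ x ⟩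
        L.seq t (block (b t) (to (M′.position t) (f h))) x
          ≡⟨ cong (λ i → L.seq t i x) (block-eq t h) ⟩
        L.seq t (block (b t) (to (M.position t) h)) x
          ≡⟨ L.seq-index t (to (M.position t) h) ⟩
        to (M.position t) h ∎
        where
        open ≡-Reasoning
        x : ℕ
        x = L.index t (to (M.position t) h)

    Codes-injective : M ≈ₘ M′ → T ≅ T′
    Codes-injective iso = record
      { σ               = σ
      ; preserves-π     = λ t h → to-injective (M′.position t) (begin
          to (M′.position t) (f (T.π t ⟨$⟩ʳ h))    ≡⟨ preserves-position t _ ⟩
          to (M.position t) (T.π t ⟨$⟩ʳ h)         ≡⟨ c.π-code t h ⟩
          to (κ t) (to (M.position t) h)           ≡⟨ cong (to (κ t)) (preserves-position t h) ⟨
          to (κ t) (to (M′.position t) (f h))      ≡⟨ c′.π-code t (f h) ⟨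
          to (M′.position t) (T′.π t ⟨$⟩ʳ f h)     ∎)
      ; preserves-root  = trans (cong f c.root-code) (trans preserves-root (sym c′.root-code))
      ; preserves-label = λ t h → to-injective (L.relabel t) (trans (c.label-code t h)
          (trans (cong (block (b t)) (sym (preserves-position t h))) (sym (c′.label-code t (f h)))))
      ; preserves-tree  = λ t h → mk⇔
          (λ h∈ → let marked , ≢r = Equivalence.to (c.tree-code (t , h)) h∈ in
            Equivalence.from (c′.tree-code (t , f h))
              ( cong (t ,_) (trans (sym (mark-eq t h)) (cong f (cong proj₂ marked)))
              , λ ≡r → ≢r (fₑ-injective (trans ≡r (sym preserves-rootₑ)))))
          (λ fh∈ → let marked , ≢r = Equivalence.to (c′.tree-code (t , f h)) fh∈ in
            Equivalence.from (c.tree-code (t , h))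
              ( cong (t ,_) (f-injective (trans (mark-eq t h) (cong proj₂ marked)))
              , λ ≡r → ≢r (trans (cong fₑ ≡r) preserves-rootₑ)))
      }
      where
      open Isomorphism iso
      open ≡-Reasoning
      mark-eq : ∀ t h → f (M.mark t h) ≡ M′.mark t (f h)
      mark-eq t = marker-natural (M.position t) (M′.position t) f (λ _ → refl) (preserves-position t)

  module Decode (M : Model k n b) where
    open Model M

    w : ∀ t → Fin n ↔ (Fin (p t) ⊎ Fin (m t))
    w = position

    π : Fin k → Permutation′ n
    π t = ↔-sym (w t) ↔-∘ (κ t ↔-∘ w t)

    π-code : ∀ t h → to (w t) (π t ⟨$⟩ʳ h) ≡ to (κ t) (to (w t) h)
    π-code t h = strictlyInverseˡ (w t) _

    lab : ∀ t → Fin n → Fin (p t)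
    lab t h = block (b t) (to (w t) h)

    lab-π : ∀ t h → lab t (π t ⟨$⟩ʳ h) ≡ lab t h
    lab-π t h = trans (cong (block (b t)) (π-code t h)) (L.lab-seq t _ _)

    lab-sound : ∀ t {h h′} → SameCycle (π t) h h′ → lab t h ≡ lab t h′
    lab-sound t = SameOrbit-invariant (lab t) (λ _ → lab-π t)

    mark-complete : ∀ t h → SameCycle (π t) h (mark t h)
    mark-complete t h = IsEquivalence.sym (SameOrbit-isEquivalence (const {B = ⊤} (π t)))
      (subst (SameCycle (π t) (mark t h)) (power-mark t (π t) (w t) (π-code t) h)
        (power-SameCycle (π t) _ (L.index t (to (w t) h))))

    lab-complete : ∀ t {h h′} → lab t h ≡ lab t h′ → SameCycle (π t) h h′
    lab-complete t {h} {h′} eq = IsEquivalence.trans equiv (mark-complete t h)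
      (IsEquivalence.sym equiv
        (subst (SameCycle (π t) h′) (cong (from (w t) ∘ inj₁) (sym eq)) (mark-complete t h′)))
      where
      equiv = SameOrbit-isEquivalence (const {B = ⊤} (π t))

    -- Advancing the type keeps the hyperedge, and passing to the mark stays in one cycle; so the
    -- walk to the root stays in one orbit.
    transitive : Transitive π
    transitive h h′ = IsEquivalence.trans equiv (to-root (reach (type-k , h)))
        (IsEquivalence.sym equiv (to-root (reach (type-k , h′))))
      where
      equiv = SameOrbit-isEquivalence π
      to-root : ∀ {v} → Reach parent rootₑ v → SameOrbit π (proj₂ v) root
      to-root (Reach.here refl)         = IsEquivalence.refl equiv
      to-root {t , h} (Reach.step _ ρ)  =
        IsEquivalence.trans equiv (SameCycle⇒SameOrbit (mark-complete (next t) h)) (to-root ρ)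

    constellation : Constellation k n
    constellation = record { π = π ; transitive = transitive }

    InTree : Fin k × Fin n → Set
    InTree v = markₑ v ≡ v × v ≢ rootₑ

    InTree? : ∀ v → Dec (InTree v)
    InTree? v = (markₑ v ≟ₑ v) ×-dec ¬? (v ≟ₑ rootₑ)

    tree : EdgeSet k n
    tree t = Vec.tabulate λ h → does (InTree? (t , h))

    tree-code : ∀ v → v ∈ₑ tree ⇔ InTree v
    tree-code (t , h) = ∈-comprehension (λ h → InTree? (t , h)) h

    mark-sound : ∀ t {h h′} → SameCycle (π t) h h′ → mark t h ≡ mark t h′
    mark-sound t c = cong (from (w t) ∘ inj₁) (lab-sound t c)

    open Marked constellation mark mark-sound mark-complete using (module FromReach)
    open FromReach (_∈ₑ tree) reach tree-code

    treeRooted : TreeRootedConstellation k n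
    treeRooted = record
      { constellation  = constellation
      ; root           = root
      ; tree           = tree
      ; isArborescence = record { spanningTree = connected , acyclic ; uniqueEdge = uniqueEdge }
      }

    labelling : VertexLabelling constellation (λ t → ℓ (γ t))
    labelling t = record
      { to        = λ h → from (L.relabel t) (lab t h)
      ; cong      = λ c → cong (from (L.relabel t)) (lab-sound t c)
      ; bijective = (λ eq → lab-complete t (to-injective (↔-sym (L.relabel t)) eq))
                  , λ i → from (w t) (inj₁ (to (L.relabel t) i)) , λ c →
                      trans (cong (from (L.relabel t)) (trans (lab-sound t c)
                        (cong (block (b t)) (strictlyInverseˡ (w t) _)))) (strictlyInverseʳ (L.relabel t) i)
      }

    relabel-lab : ∀ t {h i} → from (L.relabel t) (lab t h) ≡ i → lab t h ≡ to (L.relabel t) i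
    relabel-lab t refl = sym (strictlyInverseˡ (L.relabel t) _)

    vertexCompositions : ∀ t i → hyperdegree {C = constellation} labelling t i ≡ part (γ t) i
    vertexCompositions t i = trans
      (count-period _ (pull-HasPeriod (to (w t)) (to-injective (w t)) code (L.period t i′)) sound complete)
      (cong (part (γ t)) (strictlyInverseʳ (L.relabel t) i))
      where
      i′ : Fin (p t)
      i′ = to (L.relabel t) i
      code : ∀ x → to (w t) (power (π t) (from (w t) (inj₁ i′)) x) ≡ L.seq t i′ x
      code = power-code t (π t) (w t) (π-code t) i′
      sound : ∀ x → from (L.relabel t) (lab t (power (π t) (from (w t) (inj₁ i′)) x)) ≡ i
      sound x = trans (cong (from (L.relabel t)) (trans (cong (block (b t)) (code x)) (L.lab-seq t i′ x)))
        (strictlyInverseʳ (L.relabel t) i)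
      complete : ∀ {h} → from (L.relabel t) (lab t h) ≡ i →
                 ∃ λ x → power (π t) (from (w t) (inj₁ i′)) x ≡ h
      complete {h} eq = x , trans
          (cong (λ j → power (π t) (from (w t) (inj₁ j)) x) (sym (relabel-lab t eq)))
          (power-mark t (π t) (w t) (π-code t) h)
        where
        x : ℕ
        x = L.index t (to (w t) h)

    decoded : LabelledTreeRooted γ
    decoded = record
      { treeRooted         = treeRooted
      ; labelling          = labelling
      ; vertexCompositions = vertexCompositions
      }

    decoded-Codes : Codes decoded M
    decoded-Codes = record
      { π-code     = π-code
      ; label-code = λ t h → strictlyInverseˡ (L.relabel t) _
      ; root-code  = refl
      ; tree-code  = tree-code
      }

  module Encode (T : LabelledTreeRooted γ) where
    open LabelledTreeRooted T
    open IsArborescence isArborescence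
    open Multigraph underlyingGraph using (_≈ᵥ_; Acyclic)

    lab : ∀ t → Fin n → Fin (p t)
    lab t h = to (L.relabel t) (label t h)

    lab-sound : ∀ t {h h′} → SameCycle (π t) h h′ → lab t h ≡ lab t h′
    lab-sound t c = cong (to (L.relabel t)) (Bijection.cong (labelling t) c)

    lab-complete : ∀ t {h h′} → lab t h ≡ lab t h′ → SameCycle (π t) h h′
    lab-complete t eq = Bijection.injective (labelling t) (to-injective (L.relabel t) eq)

    -- Tree edges at the root vertex are excluded by hand, since `root∉A` becomes available only
    -- once these marks have been set up.
    IsMark : Fin k → Fin n → Set
    IsMark t h = (t , h) ≡ rootVertex ⊎ ((t , h) ∈ₑ tree × ¬ (t , h) ≈ᵥ rootVertex)

    IsMark-unique : ∀ t {h h′} → IsMark t h → IsMark t h′ → lab t h ≡ lab t h′ → h ≡ h′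
    IsMark-unique t (inj₁ refl) (inj₁ refl) _ = refl
    IsMark-unique t (inj₁ refl) (inj₂ (_ , ¬r)) eq = contradiction (refl , lab-complete t (sym eq)) ¬r
    IsMark-unique t (inj₂ (_ , ¬r)) (inj₁ refl) eq = contradiction (refl , lab-complete t eq) ¬r
    IsMark-unique t {h} {h′} (inj₂ (h∈ , ¬r)) (inj₂ (h′∈ , _)) eq with _ , _ , unique ← uniqueEdge t h ¬r =
      trans (sym (unique (h∈ , inj₁ (refl , lab-complete t refl))))
            (unique (h′∈ , inj₁ (refl , lab-complete t (sym eq))))

    marked-with-lab : ∀ t i → ∃ λ h → lab t h ≡ i × IsMark t h
    marked-with-lab t i with Bijection.surjective (labelling t) (from (L.relabel t) i)
    ... | h , label-h = choose (t Fin.≟ type-k) (label t h Fin.≟ label t root)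
      where
      lab-h : lab t h ≡ i
      lab-h = trans (cong (to (L.relabel t)) (label-h (lab-complete t refl))) (strictlyInverseˡ (L.relabel t) i)
      off-root : ¬ (t , h) ≈ᵥ rootVertex → ∃ λ h → lab t h ≡ i × IsMark t h
      off-root ¬r with uniqueEdge t h ¬r
      ... | h′ , (h′∈ , inj₁ (_ , c)) , _ = h′ , trans (lab-sound t c) lab-h
          , inj₂ (h′∈ , λ (t≡ , c′) → ¬r (t≡ , lab-complete t (trans (sym (lab-sound t c)) (lab-sound t c′))))
      ... | _ , (_ , inj₂ (next≡ , _)) , _ = contradiction next≡ (next≢ t)
      choose : Dec (t ≡ type-k) → Dec (label t h ≡ label t root) → ∃ λ h → lab t h ≡ i × IsMark t h
      choose (yes refl) (yes eq) = root , trans (cong (to (L.relabel t)) (sym eq)) lab-h , inj₁ refl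
      choose (no ≢k)    _        = off-root (≢k ∘ proj₁)
      choose _          (no ≢)   = off-root λ (_ , c) → ≢ (Bijection.cong (labelling t) c)

    markOf : ∀ t → Fin (p t) → Fin n
    markOf t i = proj₁ (marked-with-lab t i)

    lab-markOf : ∀ t i → lab t (markOf t i) ≡ i
    lab-markOf t i = proj₁ (proj₂ (marked-with-lab t i))

    mark′ : Fin k → Fin n → Fin n
    mark′ t h = markOf t (lab t h)

    mark′-IsMark : ∀ t h → IsMark t (mark′ t h)
    mark′-IsMark t h = proj₂ (proj₂ (marked-with-lab t (lab t h)))

    IsMark⇒fixed : ∀ t {h} → IsMark t h → mark′ t h ≡ h
    IsMark⇒fixed t {h} mh = IsMark-unique t (mark′-IsMark t h) mh (lab-markOf t (lab t h))

    enumeration : ∀ t → Enumeration (lab t) (part (γ t) ∘ from (L.relabel t))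
    enumeration t = record
      { seq       = λ i → power (π t) (markOf t i)
      ; index     = λ h → proj₁ (reached h)
      ; lab-seq   = λ i x → trans (sym (lab-sound t (power-SameCycle (π t) (markOf t i) x))) (lab-markOf t i)
      ; seq-index = λ h → proj₂ (reached h)
      ; period    = period
      }
      where
      reached : ∀ h → ∃ λ x → power (π t) (mark′ t h) x ≡ h
      reached h = SameCycle⇒power (π t) (lab-complete t (lab-markOf t (lab t h)))
      sound : ∀ i x → label t (power (π t) (markOf t i) x) ≡ from (L.relabel t) i
      sound i x = to≡⇒≡from (L.relabel t)
        (trans (sym (lab-sound t (power-SameCycle (π t) (markOf t i) x))) (lab-markOf t i))
      complete : ∀ i {h} → label t h ≡ from (L.relabel t) i → ∃ λ x → power (π t) (markOf t i) x ≡ h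
      complete i {h} eq with x , reaches ← reached h =
        x , trans (cong (λ j → power (π t) (markOf t j) x) (sym lab-h)) reaches
        where
        lab-h : lab t h ≡ i
        lab-h = trans (cong (to (L.relabel t)) eq) (strictlyInverseˡ (L.relabel t) i)
      period : ∀ i → HasPeriod (power (π t) (markOf t i)) (part (γ t) (from (L.relabel t) i))
      -- The length of the cycle is its number of hyperedges, which `vertexCompositions` equates
      -- with the prescribed part.
      period i with c , per ← power-period (π t) (markOf t i) = subst (HasPeriod (power (π t) (markOf t i)))
        (trans (sym (count-period _ per (sound i) (complete i))) (vertexCompositions t (from (L.relabel t) i)))
        per

    position : ∀ t → Fin n ↔ (Fin (p t) ⊎ Fin (m t))
    position t = enumerations⇒↔ (enumeration t) (L.enumeration t)

    block-position : ∀ t h → block (b t) (to (position t) h) ≡ lab t h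
    block-position t h = L.lab-seq t _ _

    mark≗ : ∀ t h → marker (b t) (position t) h ≡ mark′ t h
    mark≗ t h = begin
      from (position t) (inj₁ (block (b t) (to (position t) h)))
        ≡⟨ cong (from (position t) ∘ inj₁) (block-position t h) ⟩
      from (position t) (inj₁ (lab t h))
        ≡⟨ cong (from (position t)) (L.seq-0 t (lab t h)) ⟨
      from (position t) (L.seq t (lab t h) 0)
        ≡⟨ transfer-seq (L.enumeration t) (enumeration t) (lab t h) 0 ⟩
      mark′ t h ∎
      where open ≡-Reasoning

    mark′-sound : ∀ t {h h′} → SameCycle (π t) h h′ → mark′ t h ≡ mark′ t h′
    mark′-sound t c = cong (markOf t) (lab-sound t c)

    mark′-complete : ∀ t h → SameCycle (π t) h (mark′ t h)
    mark′-complete t h = lab-complete t (sym (lab-markOf t (lab t h)))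

    open Marked constellation mark′ mark′-sound mark′-complete
      using (markₑ; module FromAcyclic)

    root-fixed : mark′ type-k root ≡ root
    root-fixed = IsMark⇒fixed type-k (inj₁ refl)

    fixed∈tree : ∀ {v} → markₑ v ≡ v → v ≢ rootVertex → v ∈ₑ tree
    fixed∈tree {t , h} fixed ≢r with subst (IsMark t) (cong proj₂ fixed) (mark′-IsMark t h)
    ... | inj₁ ≡r       = contradiction ≡r ≢r
    ... | inj₂ (h∈ , _) = h∈

    open FromAcyclic (_∈ₑ tree) (proj₂ spanningTree) (cong (type-k ,_) root-fixed) fixed∈tree

    encoded : Model k n b
    encoded = record
      { position    = position
      ; root        = root
      ; root-marked = trans (mark≗ type-k root) root-fixed
      ; reach       = λ v → Reach-map id id refl (λ (t , h) → cong (next t ,_) (sym (mark≗ (next t) h))) (reach v)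
      }

    encoded-Codes : Codes T encoded
    encoded-Codes = record
      { π-code     = π-code
      ; label-code = λ t h → sym (block-position t h)
      ; root-code  = refl
      ; tree-code  = λ (t , h) → mk⇔
          (λ h∈ → let ¬r = λ v≈r → root∉A v≈r h∈ in
            cong (t ,_) (trans (mark≗ t h) (IsMark⇒fixed t (inj₂ (h∈ , ¬r))))
            , λ { refl → ¬r (refl , lab-complete t refl) })
          (λ (fixed , ≢r) → fixed∈tree (trans (cong (t ,_) (sym (mark≗ t h))) fixed) ≢r)
      }
      where
      π-code : ∀ t h → to (position t) (π t ⟨$⟩ʳ h) ≡ to (κ t) (to (position t) h)
      π-code t h = begin
        to (position t) (π t ⟨$⟩ʳ h)
          ≡⟨ cong (λ u → to (position t) (π t ⟨$⟩ʳ u)) (N.seq-index h) ⟨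
        to (position t) (N.seq (lab t h) (suc (N.index h)))
          ≡⟨ transfer-seq (enumeration t) (L.enumeration t) (lab t h) (suc (N.index h)) ⟩
        L.seq t (lab t h) (suc (N.index h))
          ≡⟨ κ-seq t (lab t h) (N.index h) ⟨
        to (κ t) (to (position t) h) ∎
        where
        open ≡-Reasoning
        module N = Enumeration (enumeration t)

  encoding : Bijection (𝒯 γ) (ℳ b)
  encoding = correspondence⇒Bijection (𝒯 γ) (ℳ b) Codes
    (λ T → Encode.encoded T , Encode.encoded-Codes T)
    (λ M → Decode.decoded M , Decode.decoded-Codes M)
    Codes-cong Codes-injective

  decoding : Bijection (ℳ b) (𝒯 γ)
  decoding = correspondence⇒Bijection (ℳ b) (𝒯 γ) (λ M T → Codes T M)
    (λ M → Decode.decoded M , Decode.decoded-Codes M)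
    (λ T → Encode.encoded T , Encode.encoded-Codes T)
    Codes-injective Codes-cong

theorem4p1 : ∀ (k n : ℕ) .{{_ : NonTrivial k}} .{{_ : NonZero n}}
    (γ δ : Fin k → Composition n) →
    (∀ t → ℓ (γ t) ≡ ℓ (δ t)) →
    Bijection (𝒯 γ) (𝒯 δ)
theorem4p1 k n γ δ ℓ≡ = bijection Γ.encoding (bijection (model-bijection Γ.b Δ.b) Δ.decoding)
  where
  module Γ = Coding (λ t → layout (γ t) refl)
  module Δ = Coding (λ t → layout (δ t) (sym (ℓ≡ t)))
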